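{- For integers $r \geq 3$ and $n \geq r$, the number $S_r(n)$ of $r$-monotone colorings of $\mathcal{K}^r_n$ satisfies \[2^{n^{r-1}/r^{4r}} \leq S_r(n) \leq 2^{2^{r-2}n^{r-1}/(r-1)!}.\]
   Context: $\mathcal{K}^r_n$ denotes the complete $r$-uniform hypergraph on vertex set $\{1,\dots,n\}$ ordered naturally. An $r$-monotone coloring of $\mathcal{K}^r_n$ is a map $c$ from the $r$-subsets of $\{1,\dots,n\}$ to $\{ -1,+1\}$ such that for every $(r+1)$-tuple $v_1<\dots<v_{r+1}$, writing $S=(v_1,\dots,v_{r+1})$ and $S^{(i)}$ for the $r$-set obtained by deleting $v_i$, for all $1\le i<j<k\le r+1$ we have $c(S^{(k)})\le c(S^{(j)})\le c(S^{(i)})$ or $c(S^{(k)})\ge c(S^{(j)})\ge c(S^{(i)})$ (i.e., the sequence $(c(S^{(r+1)}),\dots,c(S^{(1)}))$ changes sign at most once). -}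

module Defs where

open import Data.Nat using (ℕ; zero; suc)
open import Data.Fin using (Fin; zero; suc; _<_; _<?_)
import Data.Fin as F
open import Data.Fin.Properties using (all?)
open import Data.Vec using (Vec; []; _∷_; removeAt)
import Data.Vec as V
open import Data.Vec.Properties using (≡-dec)
open import Data.List using (List; []; _∷_; _++_; map; filter; length)
open import Data.List.Relation.Unary.All using (All)
import Data.List.Relation.Unary.All as All
open import Data.Bool using (Bool; true; false; if_then_else_)
import Data.Bool as B
import Data.Bool.Properties as BP
open import Data.Product using (_×_)
open import Data.Sum using (_⊎_)
open import Relation.Nullary using (Dec; yes; no; does)
open import Relation.Nullary.Decidable using (_×-dec_; _⊎-dec_; _→-dec_)

-- The r-subsets of the vertex set {1,…,n} (encoded as Fin n, order preserved),
-- each listed as its strictly increasing tuple (v₁ < … < vᵣ), without repetition.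
rSubsets : (n r : ℕ) → List (Vec (Fin n) r)
rSubsets n       zero    = [] ∷ []
rSubsets zero    (suc r) = []
rSubsets (suc n) (suc r) =
  map (zero ∷_) (map (V.map suc) (rSubsets n r)) ++ map (V.map suc) (rSubsets n (suc r))

-- A 2-coloring assigns a colour to each (increasing tuple of an) r-subset.
-- Colours: false = -1, true = +1 (Bool's order false ≤ true matches -1 ≤ +1).
Coloring : (n r : ℕ) → Set
Coloring n r = Vec (Fin n) r → Bool

MonotoneAt : ∀ {n r} → Coloring n r → Vec (Fin n) (suc r) → Set
MonotoneAt c S = ∀ i j k → i < j → j < k →
  ((c (removeAt S k) B.≤ c (removeAt S j)) × (c (removeAt S j) B.≤ c (removeAt S i)))
  ⊎ ((c (removeAt S i) B.≤ c (removeAt S j)) × (c (removeAt S j) B.≤ c (removeAt S k)))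

Monotone : (n r : ℕ) → Coloring n r → Set
Monotone n r c = All (MonotoneAt c) (rSubsets n (suc r))

monotoneAt? : ∀ {n r} (c : Coloring n r) (S : Vec (Fin n) (suc r)) → Dec (MonotoneAt c S)
monotoneAt? c S = all? λ i → all? λ j → all? λ k →
  (i <? j) →-dec (j <? k) →-dec
    (((c (removeAt S k) BP.≤? c (removeAt S j)) ×-dec (c (removeAt S j) BP.≤? c (removeAt S i)))
    ⊎-dec ((c (removeAt S i) BP.≤? c (removeAt S j)) ×-dec (c (removeAt S j) BP.≤? c (removeAt S k))))

monotone? : (n r : ℕ) (c : Coloring n r) → Dec (Monotone n r c)
monotone? n r c = All.all? (monotoneAt? c) (rSubsets n (suc r))

boolLists : ℕ → List (List Bool)
boolLists zero    = [] ∷ []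
boolLists (suc m) = map (true ∷_) (boolLists m) ++ map (false ∷_) (boolLists m)

-- Colouring given by a list of colours aligned with the list of r-subsets.
-- (Its values off the listed r-subsets are irrelevant and fixed to false.)
fromTable : ∀ {n r} → List (Vec (Fin n) r) → List Bool → Coloring n r
fromTable []       _        S = false
fromTable (T ∷ Ts) []       S = false
fromTable (T ∷ Ts) (b ∷ bs) S =
  if does (≡-dec F._≟_ S T) then b else fromTable Ts bs S

S : (r n : ℕ) → ℕ
S r n = length (filter (λ bs → monotone? n r (fromTable (rSubsets n r) bs))
                       (boolLists (length (rSubsets n r))))

{-# OPTIONS --safe #-}

-- Lower bound. Colour an r-set by the sign of (sum of its vertices) − M. Deleting successive vertices
-- of an (r+1)-tuple changes the sum strictly monotonically, so this is monotone however the r-sets of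
-- sum exactly M are coloured; a grid of blocks exhibits enough r-sets with a common sum.
--
-- Upper bound. The link of the first vertex and the restriction to the other vertices are monotone,
-- whence S (r+1) (n+1) ≤ S r n * S (r+1) n, and an induction reduces the bound to S 3 n ≤ 2 ^ (n * n).
-- A 3-monotone colouring is a pseudoline arrangement: c {i,a,b} tells in which order line i crosses
-- a and b. By Felsner, it is determined by the bits "the k-th line crossed by i is larger than i":
-- sweeping the crossings of one arrangement, a first crossing at which another arrangement with the
-- same bits differs would produce four lines on which the other one alternates.
module Submission where

open import Defs
open import Data.Bool using (Bool; true; false; if_then_else_)
import Data.Bool as B
import Data.Bool.Properties as Bool
open import Data.Empty using (⊥)
open import Data.Fin using (Fin; zero; suc; _<_; _<?_; _≟_; toℕ; fromℕ<; #_)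
import Data.Fin as F
import Data.Fin.Induction as Fin
import Data.Fin.Properties as Fin
open import Data.List using (List; []; _∷_; _++_; map; filter; length; take; drop; lookup; allFin; upTo; cartesianProduct; cartesianProductWith)
import Data.List.Properties as List
open import Data.List.Membership.Propositional using (_∈_; _∉_)
import Data.List.Membership.Propositional.Properties as Mem
open import Data.List.Relation.Binary.Sublist.Propositional using (_⊆_; ⊆-refl)
import Data.List.Relation.Binary.Sublist.Propositional.Properties as Sublist
open import Data.List.Relation.Unary.All using ([]; _∷_)
import Data.List.Relation.Unary.All as All
open import Data.List.Relation.Unary.Any using (here; there; index)
import Data.List.Relation.Unary.Any.Properties as Any
open import Data.List.Relation.Unary.Unique.Propositional using (Unique; []; _∷_)
import Data.List.Relation.Unary.Unique.Propositional.Properties as Unique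
open import Data.Nat using (ℕ; zero; suc; _!; _+_; _*_; _∸_; _^_; _≤_; z≤n; s≤s; NonZero; _/_; _%_)
import Data.Nat as N
import Data.Nat.DivMod as ℕ
import Data.Nat.Properties as ℕ
open import Data.Nat.Solver using (module +-*-Solver)
open import Data.Product using (_×_; _,_; proj₁; proj₂; ∃)
open import Data.Sum using (_⊎_; inj₁; inj₂)
import Data.Sum as Sum
open import Data.Unit using (⊤; tt)
open import Data.Vec using (Vec; []; _∷_; removeAt)
import Data.Vec as V
import Data.Vec.Properties as Vec
open import Data.Vec.Relation.Unary.All using ([]; _∷_)
import Data.Vec.Relation.Unary.All as VAll
import Data.Vec.Relation.Unary.All.Properties as VAll
open import Data.Vec.Relation.Unary.AllPairs using (AllPairs; []; _∷_)
import Data.Vec.Relation.Unary.AllPairs.Properties as AllPairs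
open import Function using (_∘_; Injective)
open import Induction.WellFounded using (Acc; acc; WellFounded)
open import Level using (0ℓ)
open import Relation.Binary using (Rel; tri<; tri≈; tri>)
open import Relation.Binary.PropositionalEquality
open import Relation.Nullary using (Dec; yes; no; does; ¬_; contradiction)
open import Relation.Nullary.Decidable using (dec-true; dec-false; _×-dec_; ¬?)
open import Relation.Unary using (Decidable; Pred)

-- Tables of colours

lookup-injective : ∀ {A : Set} {xs : List A} → Unique xs → Injective _≡_ _≡_ (lookup xs)
lookup-injective (_ ∷ _) {zero} {zero} _ = refl
lookup-injective {xs = _ ∷ xs} (x∉ ∷ _) {zero} {suc j} eq =
  contradiction eq (All.lookup x∉ (Mem.∈-lookup {xs = xs} j))
lookup-injective {xs = _ ∷ xs} (x∉ ∷ _) {suc i} {zero} eq =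
  contradiction (sym eq) (All.lookup x∉ (Mem.∈-lookup {xs = xs} i))
lookup-injective (_ ∷ u) {suc i} {suc j} eq = cong suc (lookup-injective u eq)

-- Sending each position in `xs` to the position of its image in `ys` gives an injection between
-- finite index sets. Injectivity is asked of `f` only on members of `xs`, since the encodings below
-- lose information elsewhere.
injection⇒length≤ : ∀ {A B : Set} (f : A → B) {xs : List A} {ys : List B} → Unique xs →
  (∀ {x} → x ∈ xs → f x ∈ ys) →
  (∀ {x y} → x ∈ xs → y ∈ xs → f x ≡ f y → x ≡ y) →
  length xs ≤ length ys
injection⇒length≤ f {xs} {ys} u into inj = Fin.injective⇒≤ {f = g} g-inj
  where
  g : Fin (length xs) → Fin (length ys)
  g i = index (into (Mem.∈-lookup {xs = xs} i))

  g-inj : Injective _≡_ _≡_ g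
  g-inj {i} {j} eq = lookup-injective u (inj (Mem.∈-lookup i) (Mem.∈-lookup j) (begin
    f (lookup xs i)  ≡⟨ Any.lookup-index (into (Mem.∈-lookup i)) ⟩
    lookup ys (g i)  ≡⟨ cong (lookup ys) eq ⟩
    lookup ys (g j)  ≡⟨ Any.lookup-index (into (Mem.∈-lookup j)) ⟨
    f (lookup xs j)  ∎))
    where open ≡-Reasoning

length-cartesianProductWith : ∀ {A B C : Set} (f : A → B → C) (xs : List A) (ys : List B) →
  length (cartesianProductWith f xs ys) ≡ length xs * length ys
length-cartesianProductWith f []       ys = refl
length-cartesianProductWith f (x ∷ xs) ys = begin
  length (map (f x) ys ++ cartesianProductWith f xs ys)           ≡⟨ List.length-++ (map (f x) ys) ⟩
  length (map (f x) ys) + length (cartesianProductWith f xs ys)   ≡⟨ cong₂ _+_ (List.length-map _ ys) (length-cartesianProductWith f xs ys) ⟩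
  length ys + length xs * length ys                               ∎
  where open ≡-Reasoning

boolLists⁺ : ∀ {m} bs → length bs ≡ m → bs ∈ boolLists m
boolLists⁺         []           refl = here refl
boolLists⁺ {suc m} (true ∷ bs)  refl = Mem.∈-++⁺ˡ (Mem.∈-map⁺ _ (boolLists⁺ bs refl))
boolLists⁺ {suc m} (false ∷ bs) refl = Mem.∈-++⁺ʳ (map (true ∷_) (boolLists m)) (Mem.∈-map⁺ _ (boolLists⁺ bs refl))

boolLists⁻ : ∀ m {bs} → bs ∈ boolLists m → length bs ≡ m
boolLists⁻ zero    (here refl) = refl
boolLists⁻ (suc m) bs∈ with Mem.∈-++⁻ (map (true ∷_) (boolLists m)) bs∈
... | inj₁ p with _ , q , refl ← Mem.∈-map⁻ _ p = cong suc (boolLists⁻ m q)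
... | inj₂ p with _ , q , refl ← Mem.∈-map⁻ _ p = cong suc (boolLists⁻ m q)

boolLists-unique : ∀ m → Unique (boolLists m)
boolLists-unique zero    = [] ∷ []
boolLists-unique (suc m) = Unique.++⁺
  (Unique.map⁺ List.∷-injectiveʳ (boolLists-unique m))
  (Unique.map⁺ List.∷-injectiveʳ (boolLists-unique m))
  λ { (p , q) → case-distinct (Mem.∈-map⁻ _ p) (Mem.∈-map⁻ _ q) }
  where
  case-distinct : ∀ {bs} → (∃ λ x → x ∈ boolLists m × bs ≡ true ∷ x) →
    (∃ λ x → x ∈ boolLists m × bs ≡ false ∷ x) → ⊥
  case-distinct (_ , _ , refl) (_ , _ , ())

length-boolLists : ∀ m → length (boolLists m) ≡ 2 ^ m
length-boolLists zero    = refl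
length-boolLists (suc m) = begin
  length (map (true ∷_) (boolLists m) ++ map (false ∷_) (boolLists m))
    ≡⟨ List.length-++ (map (true ∷_) (boolLists m)) ⟩
  length (map (true ∷_) (boolLists m)) + length (map (false ∷_) (boolLists m))
    ≡⟨ cong₂ _+_ (List.length-map _ (boolLists m)) (List.length-map _ (boolLists m)) ⟩
  length (boolLists m) + length (boolLists m)
    ≡⟨ cong₂ _+_ (length-boolLists m) (trans (length-boolLists m) (sym (ℕ.+-identityʳ _))) ⟩
  2 ^ suc m ∎
  where open ≡-Reasoning

-- Increasing tuples and the list of r-subsets

Increasing : ∀ {n r} → Vec (Fin n) r → Set
Increasing = AllPairs _<_

map-suc-injective : ∀ {n r} {S T : Vec (Fin n) r} → V.map F.suc S ≡ V.map F.suc T → S ≡ T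
map-suc-injective {S = []}    {[]}    _  = refl
map-suc-injective {S = _ ∷ _} {_ ∷ _} eq =
  cong₂ _∷_ (Fin.suc-injective (Vec.∷-injectiveˡ eq)) (map-suc-injective (Vec.∷-injectiveʳ eq))

increasing-map⁺ : ∀ {n r} {T : Vec (Fin n) r} → Increasing T → Increasing (V.map F.suc T)
increasing-map⁺ ps = AllPairs.map⁺ (relax ps)
  where
  relax : ∀ {n r} {T : Vec (Fin n) r} → Increasing T → AllPairs (λ x y → suc x < suc y) T
  relax []       = []
  relax (p ∷ ps) = VAll.map s≤s p ∷ relax ps

increasing-map⁻ : ∀ {n r} {T : Vec (Fin n) r} → Increasing (V.map F.suc T) → Increasing T
increasing-map⁻ {T = []}    []       = []
increasing-map⁻ {T = _ ∷ T} (p ∷ ps) = VAll.map N.s≤s⁻¹ (VAll.map⁻ p) ∷ increasing-map⁻ {T = T} ps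

positive⇒map-suc : ∀ {n r} {T : Vec (Fin (suc n)) r} → VAll.All (F.zero {n} <_) T →
  ∃ λ U → T ≡ V.map F.suc U
positive⇒map-suc {T = []}        []       = [] , refl
positive⇒map-suc {T = suc x ∷ T} (_ ∷ ps) with U , refl ← positive⇒map-suc {T = T} ps = x ∷ U , refl

map-suc-positive : ∀ {n r} (T : Vec (Fin n) r) → VAll.All (F.zero {n} <_) (V.map F.suc T)
map-suc-positive []      = []
map-suc-positive (_ ∷ T) = s≤s z≤n ∷ map-suc-positive T

∷-∈-rSubsets : ∀ {n r} {T : Vec (Fin n) r} → T ∈ rSubsets n r →
  zero ∷ V.map suc T ∈ rSubsets (suc n) (suc r)
∷-∈-rSubsets T∈ = Mem.∈-++⁺ˡ (Mem.∈-map⁺ _ (Mem.∈-map⁺ _ T∈))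

map-suc-∈-rSubsets : ∀ {n r} {T : Vec (Fin n) (suc r)} → T ∈ rSubsets n (suc r) →
  V.map suc T ∈ rSubsets (suc n) (suc r)
map-suc-∈-rSubsets {n} {r} T∈ = Mem.∈-++⁺ʳ (map (zero ∷_) (map (V.map suc) (rSubsets n r))) (Mem.∈-map⁺ _ T∈)

rSubsets⁻ : ∀ n r {T} → T ∈ rSubsets n r → Increasing T
rSubsets⁻ n       zero    (here refl) = []
rSubsets⁻ (suc n) (suc r) T∈ with Mem.∈-++⁻ (map (zero ∷_) (map (V.map suc) (rSubsets n r))) T∈
... | inj₁ p with _ , q , refl ← Mem.∈-map⁻ _ p with U , U∈ , refl ← Mem.∈-map⁻ _ q =
  map-suc-positive U ∷ increasing-map⁺ {T = U} (rSubsets⁻ n r U∈)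
... | inj₂ p with U , U∈ , refl ← Mem.∈-map⁻ _ p = increasing-map⁺ {T = U} (rSubsets⁻ n (suc r) U∈)

rSubsets⁺ : ∀ {n r} {T : Vec (Fin n) r} → Increasing T → T ∈ rSubsets n r
rSubsets⁺ [] = here refl
rSubsets⁺ {suc n} {T = zero ∷ T} (p ∷ ps) with U , refl ← positive⇒map-suc p =
  ∷-∈-rSubsets (rSubsets⁺ (increasing-map⁻ ps))
rSubsets⁺ {suc n} {T = suc x ∷ T} (p ∷ ps)
  with U , refl ← positive⇒map-suc (VAll.map (ℕ.≤-trans (s≤s z≤n)) p) =
  map-suc-∈-rSubsets (rSubsets⁺ (increasing-map⁻ {T = x ∷ U} (p ∷ ps)))

rSubsets-unique : ∀ n r → Unique (rSubsets n r)
rSubsets-unique n       zero    = [] ∷ []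
rSubsets-unique zero    (suc r) = []
rSubsets-unique (suc n) (suc r) = Unique.++⁺
  (Unique.map⁺ Vec.∷-injectiveʳ (Unique.map⁺ map-suc-injective (rSubsets-unique n r)))
  (Unique.map⁺ map-suc-injective (rSubsets-unique n (suc r)))
  λ { (p , q) → disjoint (Mem.∈-map⁻ _ p) (Mem.∈-map⁻ _ q) }
  where
  disjoint : ∀ {T} → (∃ λ U → U ∈ map (V.map suc) (rSubsets n r) × T ≡ zero ∷ U) →
    (∃ λ U → U ∈ rSubsets n (suc r) × T ≡ V.map suc U) → ⊥
  disjoint (_ , _ , refl) (_ ∷ _ , _ , ())

removeAt-All : ∀ {A : Set} {P : A → Set} {m} {xs : Vec A (suc m)} →
  VAll.All P xs → ∀ i → VAll.All P (removeAt xs i)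
removeAt-All (p ∷ ps)         zero    = ps
removeAt-All (p ∷ ps@(_ ∷ _)) (suc i) = p ∷ removeAt-All ps i

removeAt-AllPairs : ∀ {A : Set} {R : Rel A _} {m} {xs : Vec A (suc m)} →
  AllPairs R xs → ∀ i → AllPairs R (removeAt xs i)
removeAt-AllPairs (p ∷ ps)         zero    = ps
removeAt-AllPairs (p ∷ ps@(_ ∷ _)) (suc i) = removeAt-All p i ∷ removeAt-AllPairs ps i

removeAt-map : ∀ {A B : Set} (f : A → B) {m} (xs : Vec A (suc m)) i →
  removeAt (V.map f xs) i ≡ V.map f (removeAt xs i)
removeAt-map f (x ∷ xs)         zero    = refl
removeAt-map f (x ∷ xs@(_ ∷ _)) (suc i) = cong (f x ∷_) (removeAt-map f xs i)

removeAt-∈-rSubsets : ∀ {n r} {T : Vec (Fin n) (suc r)} →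
  T ∈ rSubsets n (suc r) → ∀ i → removeAt T i ∈ rSubsets n r
removeAt-∈-rSubsets T∈ i = rSubsets⁺ (removeAt-AllPairs (rSubsets⁻ _ _ T∈) i)

-- Reading colours from a table

fromTable-++ˡ : ∀ {n r} {Ts Us : List (Vec (Fin n) r)} {T} bs {cs} →
  length bs ≡ length Ts → T ∈ Ts → fromTable (Ts ++ Us) (bs ++ cs) T ≡ fromTable Ts bs T
fromTable-++ˡ {Ts = T′ ∷ Ts} {T = T} (b ∷ bs) len T∈ with Vec.≡-dec F._≟_ T T′ | T∈
... | yes _  | _         = refl
... | no  ≢  | here refl = contradiction refl ≢
... | no  _  | there T∈′ = fromTable-++ˡ bs (ℕ.suc-injective len) T∈′

fromTable-++ʳ : ∀ {n r} {Ts Us : List (Vec (Fin n) r)} {T} bs {cs} →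
  length bs ≡ length Ts → T ∉ Ts → fromTable (Ts ++ Us) (bs ++ cs) T ≡ fromTable Us cs T
fromTable-++ʳ {Ts = []}      []       len T∉ = refl
fromTable-++ʳ {Ts = T′ ∷ Ts} {T = T} (b ∷ bs) len T∉ with Vec.≡-dec F._≟_ T T′
... | yes eq = contradiction (here eq) T∉
... | no  _  = fromTable-++ʳ bs (ℕ.suc-injective len) (T∉ ∘ there)

fromTable-map : ∀ {n n′ r r′} {f : Vec (Fin n) r → Vec (Fin n′) r′} → Injective _≡_ _≡_ f →
  ∀ Ts bs T → fromTable (map f Ts) bs (f T) ≡ fromTable Ts bs T
fromTable-map inj []        bs       T = refl
fromTable-map inj (T′ ∷ Ts) []       T = refl
fromTable-map {f = f} inj (T′ ∷ Ts) (b ∷ bs) T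
  with Vec.≡-dec F._≟_ T T′ | Vec.≡-dec F._≟_ (f T) (f T′)
... | yes _  | yes _  = refl
... | yes eq | no  ≢  = contradiction (cong f eq) ≢
... | no  ≢  | yes eq = contradiction (inj eq) ≢
... | no  _  | no  _  = fromTable-map inj Ts bs T

fromTable-here : ∀ {n r} (T : Vec (Fin n) r) Ts b bs → fromTable (T ∷ Ts) (b ∷ bs) T ≡ b
fromTable-here T Ts b bs rewrite dec-true (Vec.≡-dec F._≟_ T T) refl = refl

fromTable-there : ∀ {n r} {T U : Vec (Fin n) r} Ts b bs → T ≢ U →
  fromTable (U ∷ Ts) (b ∷ bs) T ≡ fromTable Ts bs T
fromTable-there {T = T} {U} Ts b bs ≢ rewrite dec-false (Vec.≡-dec F._≟_ T U) ≢ = refl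

-- `fromTable` answers with the first matching entry. Since the tuples do not repeat, no entry is
-- shadowed, and the whole table can be read back.
fromTable-injective : ∀ {n r} {Ts : List (Vec (Fin n) r)} {bs cs} → Unique Ts →
  length bs ≡ length Ts → length cs ≡ length Ts →
  (∀ {T} → T ∈ Ts → fromTable Ts bs T ≡ fromTable Ts cs T) → bs ≡ cs
fromTable-injective {Ts = []}     {[]}     {[]}     _ _ _ _ = refl
fromTable-injective {Ts = T ∷ Ts} {b ∷ bs} {c ∷ cs} (T∉ ∷ u) lb lc eq = cong₂ _∷_
  (trans (sym (fromTable-here T Ts b bs)) (trans (eq (here refl)) (fromTable-here T Ts c cs)))
  (fromTable-injective u (ℕ.suc-injective lb) (ℕ.suc-injective lc) λ {U} U∈ →
    let U≢T = λ { refl → All.lookup T∉ U∈ refl } in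
    trans (sym (fromTable-there Ts b bs U≢T)) (trans (eq (there U∈)) (fromTable-there Ts c cs U≢T)))

monotoneTables : (r n : ℕ) → List (List Bool)
monotoneTables r n = filter (λ bs → monotone? n r (fromTable (rSubsets n r) bs))
                            (boolLists (length (rSubsets n r)))

∈-monotoneTables⁺ : ∀ {r n bs} → length bs ≡ length (rSubsets n r) →
  Monotone n r (fromTable (rSubsets n r) bs) → bs ∈ monotoneTables r n
∈-monotoneTables⁺ {r} {n} {bs} len mono =
  Mem.∈-filter⁺ (λ bs → monotone? n r (fromTable (rSubsets n r) bs)) (boolLists⁺ bs len) mono

∈-monotoneTables⁻ : ∀ {r n bs} → bs ∈ monotoneTables r n →
  length bs ≡ length (rSubsets n r) × Monotone n r (fromTable (rSubsets n r) bs)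
∈-monotoneTables⁻ {r} {n} bs∈
  with p , q ← Mem.∈-filter⁻ (λ bs → monotone? n r (fromTable (rSubsets n r) bs)) bs∈ =
  boolLists⁻ _ p , q

monotoneTables-unique : ∀ r n → Unique (monotoneTables r n)
monotoneTables-unique r n = Unique.filter⁺ (λ bs → monotone? n r (fromTable (rSubsets n r) bs)) (boolLists-unique (length (rSubsets n r)))

-- An increasing `f` matches the deletions in `T` with some of the deletions in `S`. It is `suc` for
-- the link, where vertex 0 is never deleted, and the identity for the restriction.
MonotoneAt-resp : ∀ {n n′ r r′} (c : Coloring n r) (c′ : Coloring n′ r′) {S T} (f : Fin (suc r′) → Fin (suc r)) →
  (∀ {i j} → i < j → f i < f j) →
  (∀ i → c (removeAt S (f i)) ≡ c′ (removeAt T i)) → MonotoneAt c S → MonotoneAt c′ T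
MonotoneAt-resp c c′ {S} {T} f f-mono eq mono i j k i<j j<k =
  Sum.map (λ (p , q) → step k j p , step j i q) (λ (p , q) → step i j p , step j k q)
    (mono (f i) (f j) (f k) (f-mono i<j) (f-mono j<k))
  where
  step : ∀ i j → c (removeAt S (f i)) B.≤ c (removeAt S (f j)) → c′ (removeAt T i) B.≤ c′ (removeAt T j)
  step i j = subst₂ B._≤_ (eq i) (eq j)

-- A colouring of the (r+1)-subsets of {0,…,n} splits into its link at vertex 0, a colouring of
-- the r-subsets of {1,…,n}, and its restriction to {1,…,n}; both inherit monotonicity.
module Split (r n : ℕ) where
  private
    link del : List (Vec (Fin (suc n)) (suc r))
    link = map (zero ∷_) (map (V.map suc) (rSubsets n r))
    del = map (V.map suc) (rSubsets n (suc r))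

    k = length (rSubsets n r)

    length-link : length link ≡ k
    length-link = trans (List.length-map _ (map (V.map suc) (rSubsets n r))) (List.length-map _ (rSubsets n r))

    module _ {bs cs : List Bool} (len : length bs ≡ k) (T : List Bool) (T≡ : T ≡ bs ++ cs) where

      link-colour : ∀ {U} → U ∈ rSubsets n r →
        fromTable (link ++ del) T (zero ∷ V.map suc U) ≡ fromTable (rSubsets n r) bs U
      link-colour {U} U∈ = begin
        fromTable (link ++ del) T (zero ∷ V.map suc U)
          ≡⟨ cong (λ T → fromTable (link ++ del) T (zero ∷ V.map suc U)) T≡ ⟩
        fromTable (link ++ del) (bs ++ cs) (zero ∷ V.map suc U)
          ≡⟨ fromTable-++ˡ bs (trans len (sym length-link)) (Mem.∈-map⁺ _ (Mem.∈-map⁺ _ U∈)) ⟩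
        fromTable link bs (zero ∷ V.map suc U)
          ≡⟨ fromTable-map Vec.∷-injectiveʳ (map (V.map suc) (rSubsets n r)) bs (V.map suc U) ⟩
        fromTable (map (V.map suc) (rSubsets n r)) bs (V.map suc U)
          ≡⟨ fromTable-map map-suc-injective (rSubsets n r) bs U ⟩
        fromTable (rSubsets n r) bs U ∎
        where open ≡-Reasoning

      del-colour : ∀ U → fromTable (link ++ del) T (V.map suc U) ≡ fromTable (rSubsets n (suc r)) cs U
      del-colour U = begin
        fromTable (link ++ del) T (V.map suc U)
          ≡⟨ cong (λ T → fromTable (link ++ del) T (V.map suc U)) T≡ ⟩
        fromTable (link ++ del) (bs ++ cs) (V.map suc U)
          ≡⟨ fromTable-++ʳ bs (trans len (sym length-link)) (not-in-link U ∘ Mem.∈-map⁻ (zero ∷_)) ⟩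
        fromTable del cs (V.map suc U)
          ≡⟨ fromTable-map map-suc-injective (rSubsets n (suc r)) cs U ⟩
        fromTable (rSubsets n (suc r)) cs U ∎
        where
        open ≡-Reasoning
        not-in-link : ∀ (U : Vec (Fin n) (suc r)) →
          (∃ λ W → W ∈ map (V.map suc) (rSubsets n r) × V.map F.suc U ≡ zero ∷ W) → ⊥
        not-in-link (_ ∷ _) (_ , _ , ())

      link-monotone : Monotone (suc n) (suc r) (fromTable (link ++ del) T) →
        Monotone n r (fromTable (rSubsets n r) bs)
      link-monotone mono = All.tabulate λ {W} W∈ →
        MonotoneAt-resp (fromTable (link ++ del) T) (fromTable (rSubsets n r) bs) {zero ∷ V.map suc W} {W} suc s≤s
          (λ i → trans (cong (fromTable (link ++ del) T) (shift W i)) (link-colour (removeAt-∈-rSubsets W∈ i)))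
          (All.lookup mono (∷-∈-rSubsets W∈))
        where
        shift : ∀ W i → removeAt (zero ∷ V.map suc W) (suc i) ≡ zero ∷ V.map suc (removeAt W i)
        shift (x ∷ W) i = cong (zero ∷_) (removeAt-map suc (x ∷ W) i)

      del-monotone : Monotone (suc n) (suc r) (fromTable (link ++ del) T) →
        Monotone n (suc r) (fromTable (rSubsets n (suc r)) cs)
      del-monotone mono = All.tabulate λ {W} W∈ →
        MonotoneAt-resp (fromTable (link ++ del) T) (fromTable (rSubsets n (suc r)) cs) {V.map suc W} {W} (λ i → i) (λ i<j → i<j)
          (λ i → trans (cong (fromTable (link ++ del) T) (removeAt-map suc W i)) (del-colour (removeAt W i)))
          (All.lookup mono (map-suc-∈-rSubsets W∈))

  -- `rSubsets` lists the sets through vertex 0 first, so cutting a table after `k` entries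
  -- separates link from restriction. Concatenation restores the table, hence the cut is injective.
  S-split : S (suc r) (suc n) ≤ S r n * S (suc r) n
  S-split = subst (S (suc r) (suc n) ≤_) (length-cartesianProductWith _,_ (monotoneTables r n) (monotoneTables (suc r) n))
    (injection⇒length≤ split (monotoneTables-unique (suc r) (suc n)) into
      λ _ _ eq → trans (sym (List.take++drop≡id k _))
        (trans (cong₂ _++_ (cong proj₁ eq) (cong proj₂ eq)) (List.take++drop≡id k _)))
    where
    split : List Bool → List Bool × List Bool
    split bs = take k bs , drop k bs

    into : ∀ {bs} → bs ∈ monotoneTables (suc r) (suc n) →
      split bs ∈ cartesianProduct (monotoneTables r n) (monotoneTables (suc r) n)
    into {bs} bs∈ =
      Mem.∈-cartesianProduct⁺
        (∈-monotoneTables⁺ {r} {n} len-link (link-monotone len-link bs split≡ mono))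
        (∈-monotoneTables⁺ {suc r} {n} len-del (del-monotone len-link bs split≡ mono))
      where
      len = proj₁ (∈-monotoneTables⁻ {suc r} {suc n} bs∈)
      mono = proj₂ (∈-monotoneTables⁻ {suc r} {suc n} bs∈)

      split≡ : bs ≡ take k bs ++ drop k bs
      split≡ = sym (List.take++drop≡id k bs)

      total : length bs ≡ k + length (rSubsets n (suc r))
      total = trans len (trans (List.length-++ link) (cong₂ _+_ length-link (List.length-map _ (rSubsets n (suc r)))))

      len-link : length (take k bs) ≡ k
      len-link = trans (List.length-take k bs) (trans (cong (k N.⊓_) total) (ℕ.m≤n⇒m⊓n≡m (ℕ.m≤m+n k _)))

      len-del : length (drop k bs) ≡ length (rSubsets n (suc r))
      len-del = trans (List.length-drop k bs) (trans (cong (N._∸ k) total) (ℕ.m+n∸m≡n k _))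

open Split public using (S-split)

-- The lower bound

weight : ∀ {n r} → Vec (Fin n) r → ℕ
weight T = V.sum (V.map toℕ T)

-- Compares deleting `x` from `x ∷ T` with deleting a later vertex: the latter trades a vertex of
-- `T` for the smaller `x`.
weight-removeAt-bound : ∀ {n r} {x : Fin n} {T : Vec (Fin n) (suc r)} →
  VAll.All (x <_) T → ∀ i → toℕ x + weight (removeAt T i) N.< weight T
weight-removeAt-bound {T = y ∷ T}     (p ∷ _)  zero    = ℕ.+-monoˡ-< (weight T) p
weight-removeAt-bound {x = x} {y ∷ T@(_ ∷ _)} (_ ∷ ps) (suc i) = begin-strict
  toℕ x + (toℕ y + weight (removeAt T i))  ≡⟨ ℕ.+-assoc (toℕ x) (toℕ y) _ ⟨
  toℕ x + toℕ y + weight (removeAt T i)    ≡⟨ cong (_+ weight (removeAt T i)) (ℕ.+-comm (toℕ x) (toℕ y)) ⟩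
  toℕ y + toℕ x + weight (removeAt T i)    ≡⟨ ℕ.+-assoc (toℕ y) (toℕ x) _ ⟩
  toℕ y + (toℕ x + weight (removeAt T i))  <⟨ ℕ.+-monoʳ-< (toℕ y) (weight-removeAt-bound ps i) ⟩
  toℕ y + weight T                         ∎
  where open ℕ.≤-Reasoning

weight-removeAt-< : ∀ {n r} {T : Vec (Fin n) (suc r)} → Increasing T →
  ∀ {i j} → i < j → weight (removeAt T j) N.< weight (removeAt T i)
weight-removeAt-< {T = _ ∷ _ ∷ _} (p ∷ _)  {zero}  {suc j} _         = weight-removeAt-bound p j
weight-removeAt-< {T = x ∷ _ ∷ _} (_ ∷ ps) {suc i} {suc j} (s≤s i<j) =
  ℕ.+-monoʳ-< (toℕ x) (weight-removeAt-< ps i<j)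

module Threshold (M : ℕ) where

  -- Colour T by the sign of weight T − M. Deleting a larger vertex leaves a smaller weight, so in
  -- each (r+1)-tuple at most one r-subset has weight exactly M and its colour can be chosen freely.
  thresholdTables : ∀ {n r} → List (Vec (Fin n) r) → List (List Bool)
  thresholdTables []       = [] ∷ []
  thresholdTables (T ∷ Ts) with ℕ.<-cmp (weight T) M
  ... | tri< _ _ _ = map (false ∷_) (thresholdTables Ts)
  ... | tri≈ _ _ _ = map (true ∷_) (thresholdTables Ts) ++ map (false ∷_) (thresholdTables Ts)
  ... | tri> _ _ _ = map (true ∷_) (thresholdTables Ts)

  balanced : ∀ {n r} → List (Vec (Fin n) r) → List (Vec (Fin n) r)
  balanced = filter (λ T → weight T ℕ.≟ M)

  -- Stated as a sublist rather than as membership, so that filtering preserves it and lengths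
  -- compare directly in `S-lower`.
  thresholdTables-⊆ : ∀ {n r} (Ts : List (Vec (Fin n) r)) → thresholdTables Ts ⊆ boolLists (length Ts)
  thresholdTables-⊆ []       = ⊆-refl
  thresholdTables-⊆ (T ∷ Ts) with ℕ.<-cmp (weight T) M
  ... | tri< _ _ _ = Sublist.++⁺ˡ (map (true ∷_) (boolLists (length Ts))) (Sublist.map⁺ (false ∷_) (thresholdTables-⊆ Ts))
  ... | tri≈ _ _ _ = Sublist.++⁺ (Sublist.map⁺ (true ∷_) (thresholdTables-⊆ Ts)) (Sublist.map⁺ (false ∷_) (thresholdTables-⊆ Ts))
  ... | tri> _ _ _ = Sublist.++⁺ʳ (map (false ∷_) (boolLists (length Ts))) (Sublist.map⁺ (true ∷_) (thresholdTables-⊆ Ts))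

  length-thresholdTables : ∀ {n r} (Ts : List (Vec (Fin n) r)) →
    length (thresholdTables Ts) ≡ 2 ^ length (balanced Ts)
  length-thresholdTables []       = refl
  length-thresholdTables (T ∷ Ts) with ℕ.<-cmp (weight T) M
  ... | tri< _ ≢ _ rewrite List.filter-reject (λ T → weight T ℕ.≟ M) {T} {Ts} ≢ =
    trans (List.length-map _ (thresholdTables Ts)) (length-thresholdTables Ts)
  ... | tri> _ ≢ _ rewrite List.filter-reject (λ T → weight T ℕ.≟ M) {T} {Ts} ≢ =
    trans (List.length-map _ (thresholdTables Ts)) (length-thresholdTables Ts)
  ... | tri≈ _ eq _ rewrite List.filter-accept (λ T → weight T ℕ.≟ M) {T} {Ts} eq = begin
    length (map (true ∷_) (thresholdTables Ts) ++ map (false ∷_) (thresholdTables Ts))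
      ≡⟨ List.length-++ (map (true ∷_) (thresholdTables Ts)) ⟩
    length (map (true ∷_) (thresholdTables Ts)) + length (map (false ∷_) (thresholdTables Ts))
      ≡⟨ cong₂ _+_ (List.length-map _ (thresholdTables Ts)) (List.length-map _ (thresholdTables Ts)) ⟩
    length (thresholdTables Ts) + length (thresholdTables Ts)
      ≡⟨ cong₂ _+_ (length-thresholdTables Ts) (trans (length-thresholdTables Ts) (sym (ℕ.+-identityʳ _))) ⟩
    2 ^ suc (length (balanced Ts)) ∎
    where open ≡-Reasoning

  Threshold : ∀ {n r} → Coloring n r → Vec (Fin n) r → Set
  Threshold c T = (weight T N.< M → c T ≡ false) × (M N.< weight T → c T ≡ true)

  threshold-∷ : ∀ {n r} {T U : Vec (Fin n) r} {Ts b bs} → Threshold (λ _ → b) U →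
    (T ∈ Ts → Threshold (fromTable Ts bs) T) → T ∈ U ∷ Ts → Threshold (fromTable (U ∷ Ts) (b ∷ bs)) T
  threshold-∷ {T = T} {U} hd tl T∈ with Vec.≡-dec F._≟_ T U | T∈
  ... | yes refl | _         = hd
  ... | no ≢     | here eq   = contradiction eq ≢
  ... | no _     | there T∈′ = tl T∈′

  thresholdTables-threshold : ∀ {n r} {T : Vec (Fin n) r} Ts {bs} →
    bs ∈ thresholdTables Ts → T ∈ Ts → Threshold (fromTable Ts bs) T
  thresholdTables-threshold (U ∷ Ts) bs∈ with ℕ.<-cmp (weight U) M
  ... | tri< _ _ ≯ with _ , cs∈ , refl ← Mem.∈-map⁻ _ bs∈ =
    threshold-∷ ((λ _ → refl) , λ gt → contradiction gt ≯) (thresholdTables-threshold Ts cs∈)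
  ... | tri> ≮ _ _ with _ , cs∈ , refl ← Mem.∈-map⁻ _ bs∈ =
    threshold-∷ ((λ lt → contradiction lt ≮) , λ _ → refl) (thresholdTables-threshold Ts cs∈)
  ... | tri≈ ≮ _ ≯ with Mem.∈-++⁻ (map (true ∷_) (thresholdTables Ts)) bs∈
  ...   | inj₁ p with _ , cs∈ , refl ← Mem.∈-map⁻ _ p =
    threshold-∷ ((λ lt → contradiction lt ≮) , λ gt → contradiction gt ≯) (thresholdTables-threshold Ts cs∈)
  ...   | inj₂ p with _ , cs∈ , refl ← Mem.∈-map⁻ _ p =
    threshold-∷ ((λ lt → contradiction lt ≮) , λ gt → contradiction gt ≯) (thresholdTables-threshold Ts cs∈)

  -- The weight of the middle deletion decides. Below `M`, deletions `j` and `k` are both `false`;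
  -- above `M`, `j` and `i` are both `true`; at `M`, `k` is `false` and `i` is `true`, whatever
  -- colour `j` has. All three cases give the first alternative.
  threshold⇒monotone : ∀ {n r} (c : Coloring n r) →
    (∀ {T} → T ∈ rSubsets n r → Threshold c T) → Monotone n r c
  threshold⇒monotone {n} {r} c thr = All.tabulate monotoneAt
    where
    false≤ : ∀ {a b} → a ≡ false → a B.≤ b
    false≤ {b = false} refl = B.b≤b
    false≤ {b = true}  refl = B.f≤t

    ≤true : ∀ {a b} → b ≡ true → a B.≤ b
    ≤true {false} refl = B.f≤t
    ≤true {true}  refl = B.b≤b

    monotoneAt : ∀ {W} → W ∈ rSubsets n (suc r) → MonotoneAt c W
    monotoneAt {W} W∈ i j k i<j j<k with ℕ.<-cmp (weight (removeAt W j)) M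
    ... | tri< wⱼ<M _ _ = inj₁ (false≤ (small k (ℕ.<-trans wₖ<wⱼ wⱼ<M)) , false≤ (small j wⱼ<M))
      where
      small = λ l → proj₁ (thr (removeAt-∈-rSubsets W∈ l))
      wₖ<wⱼ = weight-removeAt-< (rSubsets⁻ n (suc r) W∈) j<k
    ... | tri≈ _ wⱼ≡M _ = inj₁
      ( false≤ (proj₁ (thr (removeAt-∈-rSubsets W∈ k))
          (subst (_ N.<_) wⱼ≡M (weight-removeAt-< (rSubsets⁻ n (suc r) W∈) j<k)))
      , ≤true (proj₂ (thr (removeAt-∈-rSubsets W∈ i))
          (subst (N._< _) wⱼ≡M (weight-removeAt-< (rSubsets⁻ n (suc r) W∈) i<j))))
    ... | tri> _ _ M<wⱼ = inj₁ (≤true (large j M<wⱼ) , ≤true (large i (ℕ.<-trans M<wⱼ wⱼ<wᵢ)))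
      where
      large = λ l → proj₂ (thr (removeAt-∈-rSubsets W∈ l))
      wⱼ<wᵢ = weight-removeAt-< (rSubsets⁻ n (suc r) W∈) i<j

  S-lower : ∀ r n → 2 ^ length (balanced (rSubsets n r)) ≤ S r n
  S-lower r n = begin
    2 ^ length (balanced (rSubsets n r))     ≡⟨ length-thresholdTables (rSubsets n r) ⟨
    length (thresholdTables (rSubsets n r))  ≡⟨ cong length (List.filter-all P? (All.tabulate λ bs∈ →
      threshold⇒monotone _ (thresholdTables-threshold (rSubsets n r) bs∈))) ⟨
    length (filter P? (thresholdTables (rSubsets n r)))
      ≤⟨ Sublist.length-mono-≤ (Sublist.filter⁺ P? P? (λ { refl p → p }) (thresholdTables-⊆ (rSubsets n r))) ⟩
    S r n ∎
    where
    open ℕ.≤-Reasoning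
    P? = λ bs → monotone? n r (fromTable (rSubsets n r) bs)

-- With q = p+1, the j-th of the first s vertices ranges over the block [jq, (j+1)q), and the last
-- vertex compensates: b accumulates the offsets by which earlier vertices fall short of the top
-- of their block, so that the total weight does not depend on the choices.
module Grid (p m : ℕ) where

  private q = suc p

  -- Each vertex advances the block start `a` by `q` and adds at most `p` to the debt `b`. Reserving
  -- `p + q` per remaining vertex therefore keeps the last vertex, placed at `a + b`, at most `m`.
  shift-≤ : ∀ s a b (x : Fin q) → a + b + suc s * (p + q) ≤ m → (a + q) + (b + (p ∸ toℕ x)) + s * (p + q) ≤ m
  shift-≤ s a b x h = begin
    a + q + (b + (p ∸ toℕ x)) + s * (p + q) ≤⟨ ℕ.+-monoˡ-≤ _ (ℕ.+-monoʳ-≤ (a + q) (ℕ.+-monoʳ-≤ b (ℕ.m∸n≤m p (toℕ x)))) ⟩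
    a + q + (b + p) + s * (p + q)
      ≡⟨ solve 5 (λ a b p q e → a :+ q :+ (b :+ p) :+ e := a :+ b :+ (p :+ q :+ e)) refl a b p q (s * (p + q)) ⟩
    a + b + (p + q + s * (p + q)) ≤⟨ h ⟩
    m ∎
    where
    open ℕ.≤-Reasoning
    open +-*-Solver

  vertex-< : ∀ s a b (x : Fin q) → a + b + suc s * (p + q) ≤ m → a + toℕ x N.< suc m
  vertex-< s a b x h = s≤s (begin
    a + toℕ x ≤⟨ ℕ.+-monoʳ-≤ a (Fin.toℕ≤pred[n] x) ⟩
    a + p     ≤⟨ ℕ.+-mono-≤ (ℕ.m≤m+n a b) (ℕ.≤-trans (ℕ.m≤m+n p q) (ℕ.m≤m+n (p + q) (s * (p + q)))) ⟩
    a + b + suc s * (p + q) ≤⟨ h ⟩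
    m ∎)
    where open ℕ.≤-Reasoning

  gridSet : ∀ {s} a b → Vec (Fin q) s → a + b + s * (p + q) ≤ m → Vec (Fin (suc m)) (suc s)
  gridSet a b []       h = fromℕ< (s≤s (ℕ.≤-trans (ℕ.m≤m+n (a + b) 0) h)) ∷ []
  gridSet {suc s} a b (x ∷ xs) h = fromℕ< (vertex-< s a b x h) ∷ gridSet (a + q) (b + (p ∸ toℕ x)) xs (shift-≤ s a b x h)

  -- The total weight when every vertex is at the top of its block and the last vertex has no debt
  -- to pay.
  gridWeight : ℕ → ℕ → ℕ
  gridWeight zero    a = a
  gridWeight (suc s) a = a + p + gridWeight s (a + q)

  weight-gridSet : ∀ {s} a b (xs : Vec (Fin q) s) h → weight (gridSet a b xs h) ≡ b + gridWeight s a
  weight-gridSet a b [] h = trans (ℕ.+-identityʳ _) (trans (Fin.toℕ-fromℕ< _) (ℕ.+-comm a b))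
  weight-gridSet {suc s} a b (x ∷ xs) h = begin
    toℕ (fromℕ< (vertex-< s a b x h)) + weight (gridSet (a + q) (b + (p ∸ toℕ x)) xs (shift-≤ s a b x h))
      ≡⟨ cong₂ _+_ (Fin.toℕ-fromℕ< (vertex-< s a b x h)) (weight-gridSet (a + q) (b + (p ∸ toℕ x)) xs (shift-≤ s a b x h)) ⟩
    a + toℕ x + (b + (p ∸ toℕ x) + gridWeight s (a + q))
      ≡⟨ solve 5 (λ a x b y w → a :+ x :+ (b :+ y :+ w) := b :+ (a :+ (x :+ y) :+ w)) refl
           a (toℕ x) b (p ∸ toℕ x) (gridWeight s (a + q)) ⟩
    b + (a + (toℕ x + (p ∸ toℕ x)) + gridWeight s (a + q))
      ≡⟨ cong (λ y → b + (a + y + gridWeight s (a + q))) (ℕ.m+[n∸m]≡n (Fin.toℕ≤pred[n] x)) ⟩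
    b + (a + p + gridWeight s (a + q)) ∎
    where
    open ≡-Reasoning
    open +-*-Solver

  gridSet-≥ : ∀ {s} a b (xs : Vec (Fin q) s) h → VAll.All (λ v → a ≤ toℕ v) (gridSet a b xs h)
  gridSet-≥ a b [] h = subst (a ≤_) (sym (Fin.toℕ-fromℕ< _)) (ℕ.m≤m+n a b) ∷ []
  gridSet-≥ {suc s} a b (x ∷ xs) h = subst (a ≤_) (sym (Fin.toℕ-fromℕ< _)) (ℕ.m≤m+n a (toℕ x)) ∷
    VAll.map (ℕ.≤-trans (ℕ.m≤m+n a q)) (gridSet-≥ (a + q) (b + (p ∸ toℕ x)) xs (shift-≤ s a b x h))

  gridSet-increasing : ∀ {s} a b (xs : Vec (Fin q) s) h → Increasing (gridSet a b xs h)
  gridSet-increasing a b [] h = [] ∷ []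
  gridSet-increasing {suc s} a b (x ∷ xs) h =
    VAll.map (ℕ.<-≤-trans (subst (N._< a + q) (sym (Fin.toℕ-fromℕ< _)) (ℕ.+-monoʳ-< a (Fin.toℕ<n x))))
      (gridSet-≥ (a + q) (b + (p ∸ toℕ x)) xs (shift-≤ s a b x h)) ∷
    gridSet-increasing (a + q) (b + (p ∸ toℕ x)) xs (shift-≤ s a b x h)

  gridSet-injective : ∀ {s} a b (xs ys : Vec (Fin q) s) {h h′} → gridSet a b xs h ≡ gridSet a b ys h′ → xs ≡ ys
  gridSet-injective a b [] [] eq = refl
  gridSet-injective {suc s} a b (x ∷ xs) (y ∷ ys) {h} {h′} eq
    with refl ← Fin.toℕ-injective (ℕ.+-cancelˡ-≡ a _ _ (trans (sym (Fin.toℕ-fromℕ< (vertex-< s a b x h)))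
                  (trans (cong toℕ (Vec.∷-injectiveˡ eq)) (Fin.toℕ-fromℕ< (vertex-< s a b y h′))))) =
    cong (x ∷_) (gridSet-injective (a + q) (b + (p ∸ toℕ x)) xs ys (Vec.∷-injectiveʳ eq))

  allVecs : ∀ s → List (Vec (Fin q) s)
  allVecs zero    = [] ∷ []
  allVecs (suc s) = cartesianProductWith _∷_ (allFin q) (allVecs s)

  allVecs-unique : ∀ s → Unique (allVecs s)
  allVecs-unique zero    = [] ∷ []
  allVecs-unique (suc s) = Unique.cartesianProductWith⁺ _∷_ Vec.∷-injective (Unique.allFin⁺ q) (allVecs-unique s)

  length-allVecs : ∀ s → length (allVecs s) ≡ q ^ s
  length-allVecs zero    = refl
  length-allVecs (suc s) = trans (length-cartesianProductWith _∷_ (allFin q) (allVecs s))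
    (cong₂ _*_ (List.length-tabulate {n = q} (λ i → i)) (length-allVecs s))

  S-grid : ∀ s → s * (p + q) ≤ m → 2 ^ (q ^ s) ≤ S (suc s) (suc m)
  S-grid s h = ℕ.≤-trans (ℕ.^-monoʳ-≤ 2 enough) (S-lower (suc s) (suc m))
    where
    open Threshold (gridWeight s 0)

    enough : q ^ s ≤ length (balanced (rSubsets (suc m) (suc s)))
    enough = subst (_≤ length (balanced (rSubsets (suc m) (suc s)))) (length-allVecs s)
      (injection⇒length≤ (λ xs → gridSet 0 0 xs h) (allVecs-unique s)
        (λ {xs} _ → Mem.∈-filter⁺ (λ T → weight T ℕ.≟ gridWeight s 0)
          (rSubsets⁺ (gridSet-increasing 0 0 xs h)) (weight-gridSet 0 0 xs h))
        (λ {xs} {ys} _ _ → gridSet-injective 0 0 xs ys))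

-- Choice of the block length

^-distribʳ-* : ∀ k a b → (a * b) ^ k ≡ a ^ k * b ^ k
^-distribʳ-* zero    a b = refl
^-distribʳ-* (suc k) a b = trans (cong (a * b *_) (^-distribʳ-* k a b))
  (solve 4 (λ a b x y → a :* b :* (x :* y) := a :* x :* (b :* y)) refl a b (a ^ k) (b ^ k))
  where open +-*-Solver

4*s≤[1+s]^4 : ∀ s .{{_ : NonZero s}} → 4 * s ≤ suc s ^ 4
4*s≤[1+s]^4 s = begin
  4 * s             ≡⟨ ℕ.*-comm 4 s ⟩
  s * 4             ≤⟨ ℕ.*-mono-≤ (ℕ.n≤1+n s) (ℕ.≤-trans (ℕ.m≤m+n 4 4) (ℕ.^-monoˡ-≤ 3 (s≤s (N.>-nonZero⁻¹ s)))) ⟩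
  suc s * suc s ^ 3 ∎
  where open ℕ.≤-Reasoning

-- Here `r = suc s`, and the denominator of the exponent is cleared by raising to that power. With
-- the blocks as long as they fit, `suc m` is at most `4 * s` block lengths, so passing to the grid
-- costs a factor `(4 * s) ^ s` in the exponent, which `r ^ (4 * r)` covers.
lower-bound : ∀ s m .{{_ : NonZero s}} → s ≤ m →
  2 ^ (suc m ^ s) ≤ S (suc s) (suc m) ^ (suc s ^ (4 * suc s))
lower-bound s m s≤m = begin
  2 ^ (suc m ^ s)                        ≤⟨ ℕ.^-monoʳ-≤ 2 exponent ⟩
  2 ^ (suc p ^ s * suc s ^ (4 * suc s))  ≡⟨ ℕ.^-*-assoc 2 (suc p ^ s) _ ⟨
  (2 ^ (suc p ^ s)) ^ (suc s ^ (4 * suc s)) ≤⟨ ℕ.^-monoˡ-≤ (suc s ^ (4 * suc s)) (Grid.S-grid p m s fits) ⟩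
  S (suc s) (suc m) ^ (suc s ^ (4 * suc s)) ∎
  where
  open ℕ.≤-Reasoning
  open +-*-Solver

  instance
    2*s≢0 : NonZero (2 * s)
    2*s≢0 = ℕ.m*n≢0 2 s

  -- The grid needs `s * (2 * p + 1) ≤ m`; this quotient is the largest such `p`.
  d = m ∸ s
  p = d / (2 * s)

  m≡ : m ≡ s + (d % (2 * s) + p * (2 * s))
  m≡ = trans (sym (ℕ.m+[n∸m]≡n s≤m)) (cong (s +_) (ℕ.m≡m%n+[m/n]*n d (2 * s)))

  fits : s * (p + suc p) ≤ m
  fits = begin
    s * (p + suc p)                    ≡⟨ solve 2 (λ s p → s :* (p :+ (con 1 :+ p)) := s :+ p :* (con 2 :* s)) refl s p ⟩
    s + p * (2 * s)                    ≤⟨ ℕ.+-monoʳ-≤ s (ℕ.m≤n+m _ (d % (2 * s))) ⟩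
    s + (d % (2 * s) + p * (2 * s))    ≡⟨ m≡ ⟨
    m                                  ∎

  wide : suc m ≤ 4 * s * suc p
  wide = begin
    suc m                                  ≡⟨ cong suc m≡ ⟩
    suc (s + (d % (2 * s) + p * (2 * s)))  ≡⟨ ℕ.+-suc s _ ⟨
    s + (suc (d % (2 * s)) + p * (2 * s))  ≤⟨ ℕ.+-monoʳ-≤ s (ℕ.+-monoˡ-≤ (p * (2 * s)) (ℕ.m%n<n d (2 * s))) ⟩
    -- The added term rounds the sum up to a multiple of `suc p`.
    s + (2 * s + p * (2 * s))              ≤⟨ ℕ.m≤m+n _ (s + 2 * (p * s)) ⟩
    s + (2 * s + p * (2 * s)) + (s + 2 * (p * s))
      ≡⟨ solve 2 (λ s p → s :+ (con 2 :* s :+ p :* (con 2 :* s)) :+ (s :+ con 2 :* (p :* s)) := con 4 :* s :* (con 1 :+ p)) refl s p ⟩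
    4 * s * suc p ∎

  exponent : suc m ^ s ≤ suc p ^ s * suc s ^ (4 * suc s)
  exponent = begin
    suc m ^ s                        ≤⟨ ℕ.^-monoˡ-≤ s wide ⟩
    (4 * s * suc p) ^ s              ≡⟨ ^-distribʳ-* s (4 * s) (suc p) ⟩
    (4 * s) ^ s * suc p ^ s          ≡⟨ ℕ.*-comm ((4 * s) ^ s) (suc p ^ s) ⟩
    suc p ^ s * (4 * s) ^ s          ≤⟨ ℕ.*-monoʳ-≤ (suc p ^ s) (begin
      (4 * s) ^ s          ≤⟨ ℕ.^-monoˡ-≤ s (4*s≤[1+s]^4 s) ⟩
      (suc s ^ 4) ^ s      ≡⟨ ℕ.^-*-assoc (suc s) 4 s ⟩
      suc s ^ (4 * s)      ≤⟨ ℕ.^-monoʳ-≤ (suc s) (ℕ.*-monoʳ-≤ 4 (ℕ.n≤1+n s)) ⟩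
      suc s ^ (4 * suc s)  ∎) ⟩
    suc p ^ s * suc s ^ (4 * suc s)  ∎

-- Colourings of triples

-- Putting `z` in front of `filter P? xs` leaves a list without repetition whose members all lie in
-- `filter Q? xs`.
length-filter-< : ∀ {A : Set} {P Q : Pred A 0ℓ} (P? : Decidable P) (Q? : Decidable Q) {xs z} → Unique xs →
  (∀ {x} → P x → Q x) → z ∈ xs → ¬ P z → Q z → length (filter P? xs) N.< length (filter Q? xs)
length-filter-< P? Q? {xs} {z} u P⊆Q z∈ ¬Pz Qz =
  injection⇒length≤ (λ x → x) {xs = z ∷ filter P? xs}
    (All.tabulate (λ { x∈ refl → ¬Pz (proj₂ (Mem.∈-filter⁻ P? {xs = xs} x∈)) }) ∷ Unique.filter⁺ P? u)
    (λ { (here refl) → Mem.∈-filter⁺ Q? z∈ Qz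
       ; (there x∈)  → let x∈xs , Px = Mem.∈-filter⁻ P? {xs = xs} x∈ in Mem.∈-filter⁺ Q? x∈xs (P⊆Q Px) })
    (λ _ _ eq → eq)

map-injective-∈ : ∀ {A B : Set} {f g : A → B} {xs x} → map f xs ≡ map g xs → x ∈ xs → f x ≡ g x
map-injective-∈ eq (here refl) = List.∷-injectiveˡ eq
map-injective-∈ eq (there x∈)  = map-injective-∈ (List.∷-injectiveʳ eq) x∈

≡-does : ∀ {P Q : Set} (P? : Dec P) (Q? : Dec Q) → (P → Q) → (Q → P) → does P? ≡ does Q?
≡-does (yes p) Q? P→Q Q→P = sym (dec-true Q? (P→Q p))
≡-does (no ¬p) Q? P→Q Q→P = sym (dec-false Q? (¬p ∘ Q→P))

module Colour {n : ℕ} (f : Fin n → Fin n → Fin n → Bool) where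

  -- The extension of `f` from increasing triples to all orders of three distinct vertices: sort,
  -- then apply `f`. It makes statements about a line independent of where its index lies among the
  -- others.
  colour : Fin n → Fin n → Fin n → Bool
  colour x y z =
    if does (x <? y) then
      (if does (y <? z) then f x y z else if does (x <? z) then f x z y else f z x y)
    else
      (if does (x <? z) then f y x z else if does (y <? z) then f y z x else f z y x)

  module _ {x y z : Fin n} (x<y : x < y) (y<z : y < z) where
    private
      x<z : x < z
      x<z = Fin.<-trans x<y y<z

      lt : ∀ {u v : Fin n} → u < v → does (u <? v) ≡ true
      lt {u} {v} = dec-true (u <? v)

      gt : ∀ {u v : Fin n} → v < u → does (u <? v) ≡ false
      gt {u} {v} v<u = dec-false (u <? v) (Fin.<-asym v<u)

    colour-xyz : colour x y z ≡ f x y z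
    colour-xyz rewrite lt x<y | lt y<z = refl

    colour-xzy : colour x z y ≡ f x y z
    colour-xzy rewrite lt x<z | gt y<z | lt x<y = refl

    colour-yxz : colour y x z ≡ f x y z
    colour-yxz rewrite gt x<y | lt y<z = refl

    colour-yzx : colour y z x ≡ f x y z
    colour-yzx rewrite lt y<z | gt x<z | gt x<y = refl

    colour-zxy : colour z x y ≡ f x y z
    colour-zxy rewrite gt x<z | gt y<z | lt x<y = refl

    colour-zyx : colour z y x ≡ f x y z
    colour-zyx rewrite gt y<z | gt x<z | gt x<y = refl

  data Order (x y z : Fin n) : Set where
    xyz : x < y → y < z → Order x y z
    xzy : x < z → z < y → Order x y z
    yxz : y < x → x < z → Order x y z
    yzx : y < z → z < x → Order x y z
    zxy : z < x → x < y → Order x y z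
    zyx : z < y → y < x → Order x y z

  order : ∀ {x y z} → x ≢ y → x ≢ z → y ≢ z → Order x y z
  order {x} {y} {z} x≢y x≢z y≢z with Fin.<-cmp x y | Fin.<-cmp y z | Fin.<-cmp x z
  ... | tri≈ _ eq _ | _            | _            = contradiction eq x≢y
  ... | _           | tri≈ _ eq _  | _            = contradiction eq y≢z
  ... | _           | _            | tri≈ _ eq _  = contradiction eq x≢z
  ... | tri< x<y _ _ | tri< y<z _ _ | _           = xyz x<y y<z
  ... | tri< x<y _ _ | tri> _ _ z<y | tri< x<z _ _ = xzy x<z z<y
  ... | tri< x<y _ _ | tri> _ _ z<y | tri> _ _ z<x = zxy z<x x<y
  ... | tri> _ _ y<x | tri< y<z _ _ | tri< x<z _ _ = yxz y<x x<z
  ... | tri> _ _ y<x | tri< y<z _ _ | tri> _ _ z<x = yzx y<z z<x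
  ... | tri> _ _ y<x | tri> _ _ z<y | _           = zyx z<y y<x

  colour-swap₂₃ : ∀ {x y z} → x ≢ y → x ≢ z → y ≢ z → colour x y z ≡ colour x z y
  colour-swap₂₃ x≢y x≢z y≢z with order x≢y x≢z y≢z
  ... | xyz p q = trans (colour-xyz p q) (sym (colour-xzy p q))
  ... | xzy p q = trans (colour-xzy p q) (sym (colour-xyz p q))
  ... | yxz p q = trans (colour-yxz p q) (sym (colour-yzx p q))
  ... | yzx p q = trans (colour-zxy p q) (sym (colour-zyx p q))
  ... | zxy p q = trans (colour-yzx p q) (sym (colour-yxz p q))
  ... | zyx p q = trans (colour-zyx p q) (sym (colour-zxy p q))

  colour-swap₁₂ : ∀ {x y z} → x ≢ y → x ≢ z → y ≢ z → colour x y z ≡ colour y x z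
  colour-swap₁₂ x≢y x≢z y≢z with order x≢y x≢z y≢z
  ... | xyz p q = trans (colour-xyz p q) (sym (colour-yxz p q))
  ... | xzy p q = trans (colour-xzy p q) (sym (colour-zxy p q))
  ... | yxz p q = trans (colour-yxz p q) (sym (colour-xyz p q))
  ... | yzx p q = trans (colour-zxy p q) (sym (colour-xzy p q))
  ... | zxy p q = trans (colour-yzx p q) (sym (colour-zyx p q))
  ... | zyx p q = trans (colour-zyx p q) (sym (colour-yzx p q))

  -- Vertices are read as pseudolines: i ⊢ a ≺ b says that line i crosses a before b.
  infix 4 _⊢_≺_ _⊢_≺?_
  _⊢_≺_ : Fin n → Fin n → Fin n → Set
  i ⊢ a ≺ b = (i ≢ a × i ≢ b × a ≢ b) × colour i a b ≡ does (a <? b)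

  _⊢_≺?_ : ∀ i a b → Dec (i ⊢ a ≺ b)
  i ⊢ a ≺? b = (¬? (i ≟ a) ×-dec ¬? (i ≟ b) ×-dec ¬? (a ≟ b)) ×-dec (colour i a b Bool.≟ does (a <? b))

  rank : Fin n → Fin n → ℕ
  rank i z = length (filter (i ⊢_≺? z) (allFin n))

  RightAt : Fin n → ℕ → Fin n → Set
  RightAt i k z = i ≢ z × rank i z ≡ k × i < z

  rightAt? : ∀ i k → Dec (∃ (RightAt i k))
  rightAt? i k = Fin.any? λ z → ¬? (i ≟ z) ×-dec (rank i z ℕ.≟ k) ×-dec (i <? z)

  -- Felsner's replace matrix: is the k-th line crossed by line i one with a larger index?
  replaceBit : Fin n → ℕ → Bool
  replaceBit i k = does (rightAt? i k)

-- Lists the triples of `i < j < k < l` as `ijk`, `ijl`, `ikl`, `jkl`. For any three of these four,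
-- equal outer colours force the middle colour, which is the condition of at most one sign change;
-- the subscripts name the three triples.
record Signotope {n : ℕ} (f : Fin n → Fin n → Fin n → Bool) : Set where
  field
    s₁₂₃ : ∀ {i j k l} → i < j → j < k → k < l → f i j k ≡ f i k l → f i j l ≡ f i j k
    s₁₂₄ : ∀ {i j k l} → i < j → j < k → k < l → f i j k ≡ f j k l → f i j l ≡ f i j k
    s₁₃₄ : ∀ {i j k l} → i < j → j < k → k < l → f i j k ≡ f j k l → f i k l ≡ f i j k
    s₂₃₄ : ∀ {i j k l} → i < j → j < k → k < l → f i j l ≡ f j k l → f i k l ≡ f i j l

-- The crossing orders along the lines of one arrangement

module Lines {n : ℕ} {f : Fin n → Fin n → Fin n → Bool} (sig : Signotope f) where
  open Signotope sig
  open Colour f public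

  does-flip : ∀ {a b : Fin n} → a ≢ b → does (a <? b) ≢ does (b <? a)
  does-flip {a} {b} a≢b with Fin.<-cmp a b
  ... | tri< a<b _ b≮a rewrite dec-true (a <? b) a<b | dec-false (b <? a) b≮a = λ ()
  ... | tri≈ _ eq _ = contradiction eq a≢b
  ... | tri> a≮b _ b<a rewrite dec-false (a <? b) a≮b | dec-true (b <? a) b<a = λ ()

  ≺-asym : ∀ {i a b} → i ⊢ a ≺ b → ¬ i ⊢ b ≺ a
  ≺-asym ((i≢a , i≢b , a≢b) , p) (_ , q) =
    does-flip a≢b (trans (sym p) (trans (colour-swap₂₃ i≢a i≢b a≢b) q))

  ≺-total : ∀ {i a b} → i ≢ a → i ≢ b → a ≢ b → i ⊢ a ≺ b ⊎ i ⊢ b ≺ a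
  ≺-total {i} {a} {b} i≢a i≢b a≢b with colour i a b Bool.≟ does (a <? b)
  ... | yes p = inj₁ ((i≢a , i≢b , a≢b) , p)
  ... | no ¬p = inj₂ ((i≢b , i≢a , a≢b ∘ sym) , (begin
    colour i b a             ≡⟨ colour-swap₂₃ i≢a i≢b a≢b ⟨
    colour i a b             ≡⟨ Bool.¬-not ¬p ⟩
    B.not (does (a <? b))    ≡⟨ Bool.¬-not (does-flip (a≢b ∘ sym)) ⟨
    does (b <? a)            ∎))
    where open ≡-Reasoning

  -- Of the four triples of `i`, `u`, `v`, `w`, the three containing `i` appear in lexicographic
  -- order as `uv`, `uw`, `vw`, wherever `i` lies. Its place among `u < v < w` selects the axiom.
  colour-between : ∀ {i u v w} → i ≢ u → i ≢ v → i ≢ w → u < v → v < w →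
    colour i u v ≡ colour i v w → colour i u w ≡ colour i u v
  colour-between {i} {u} {v} {w} i≢u i≢v i≢w u<v v<w eq
    with Fin.<-cmp i u | Fin.<-cmp i v | Fin.<-cmp i w
  ... | tri≈ _ e _ | _ | _ = contradiction e i≢u
  ... | _ | tri≈ _ e _ | _ = contradiction e i≢v
  ... | _ | _ | tri≈ _ e _ = contradiction e i≢w
  ... | tri< i<u _ _ | _ | _ =
    subst₂ _≡_ (sym (colour-xyz i<u (Fin.<-trans u<v v<w))) (sym (colour-xyz i<u u<v))
      (s₁₂₃ i<u u<v v<w (subst₂ _≡_ (colour-xyz i<u u<v) (colour-xyz (Fin.<-trans i<u u<v) v<w) eq))
  ... | tri> _ _ u<i | tri< i<v _ _ | _ =
    subst₂ _≡_ (sym (colour-yxz u<i (Fin.<-trans i<v v<w))) (sym (colour-yxz u<i i<v))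
      (s₁₂₄ u<i i<v v<w (subst₂ _≡_ (colour-yxz u<i i<v) (colour-xyz i<v v<w) eq))
  ... | _ | tri> _ _ v<i | tri< i<w _ _ =
    subst₂ _≡_ (sym (colour-yxz (Fin.<-trans u<v v<i) i<w)) (sym (colour-zxy u<v v<i))
      (s₁₃₄ u<v v<i i<w (subst₂ _≡_ (colour-zxy u<v v<i) (colour-yxz v<i i<w) eq))
  ... | _ | _ | tri> _ _ w<i =
    subst₂ _≡_ (sym (colour-zxy (Fin.<-trans u<v v<w) w<i)) (sym (colour-zxy u<v (Fin.<-trans v<w w<i)))
      (s₂₃₄ u<v v<w w<i (subst₂ _≡_ (colour-zxy u<v (Fin.<-trans v<w w<i)) (colour-zxy v<w w<i) eq))

  ≺-up : ∀ {i a b} → a < b → i ⊢ a ≺ b → colour i a b ≡ true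
  ≺-up {i} {a} {b} a<b (_ , p) = trans p (dec-true (a <? b) a<b)

  ≺-down : ∀ {i a b} → b < a → i ⊢ a ≺ b → colour i a b ≡ false
  ≺-down {i} {a} {b} b<a (_ , p) = trans p (dec-false (a <? b) (Fin.<-asym b<a))

  ≺-down′ : ∀ {i a b} → b < a → i ⊢ a ≺ b → colour i b a ≡ false
  ≺-down′ {i} {a} {b} b<a p@((i≢a , i≢b , a≢b) , _) =
    trans (sym (colour-swap₂₃ i≢a i≢b a≢b)) (≺-down b<a p)

  -- A cycle, rotated to begin at its smallest line, would give the two neighbouring pairs one
  -- colour and the outer pair the other, against `colour-between`.
  ≺-acyclic-min : ∀ {i a b d} → a < b → a < d → i ⊢ a ≺ b → i ⊢ b ≺ d → ¬ i ⊢ d ≺ a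
  ≺-acyclic-min {i} {a} {b} {d} a<b a<d p@((i≢a , i≢b , _) , _) q@((_ , i≢d , b≢d) , _) r with Fin.<-cmp b d
  ... | tri≈ _ eq _ = b≢d eq
  ... | tri< b<d _ _ = contradiction
    (trans (sym (≺-up a<b p)) (trans (sym (colour-between i≢a i≢b i≢d a<b b<d
      (trans (≺-up a<b p) (sym (≺-up b<d q))))) (≺-down′ a<d r))) λ ()
  ... | tri> _ _ d<b = contradiction
    (trans (sym (≺-up a<b p)) (trans (colour-between i≢a i≢d i≢b a<d d<b
      (trans (≺-down′ a<d r) (sym (≺-down′ d<b q)))) (≺-down′ a<d r))) λ ()

  ≺-acyclic : ∀ {i a b d} → i ⊢ a ≺ b → i ⊢ b ≺ d → ¬ i ⊢ d ≺ a
  ≺-acyclic p@((_ , _ , a≢b) , _) q@((_ , _ , b≢d) , _) r@((_ , _ , d≢a) , _)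
    with order a≢b (d≢a ∘ sym) b≢d
  ... | xyz a<b b<d = ≺-acyclic-min a<b (Fin.<-trans a<b b<d) p q r
  ... | xzy a<d d<b = ≺-acyclic-min (Fin.<-trans a<d d<b) a<d p q r
  ... | yxz b<a a<d = ≺-acyclic-min (Fin.<-trans b<a a<d) b<a q r p
  ... | yzx b<d d<a = ≺-acyclic-min b<d (Fin.<-trans b<d d<a) q r p
  ... | zxy d<a a<b = ≺-acyclic-min d<a (Fin.<-trans d<a a<b) r p q
  ... | zyx d<b b<a = ≺-acyclic-min (Fin.<-trans d<b b<a) d<b r p q

  ≺-trans : ∀ {i a b d} → i ⊢ a ≺ b → i ⊢ b ≺ d → i ⊢ a ≺ d
  ≺-trans {i} {a} {b} {d} p@((i≢a , _ , _) , _) q@((_ , i≢d , _) , _) with a ≟ d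
  ... | yes refl = contradiction q (≺-asym p)
  ... | no a≢d with ≺-total i≢a i≢d a≢d
  ...   | inj₁ r = r
  ...   | inj₂ r = contradiction r (≺-acyclic p q)

  ≺-wellFounded : ∀ i → WellFounded (i ⊢_≺_)
  ≺-wellFounded i = Fin.spo-wellFounded {_≈_ = _≡_} record
    { isEquivalence = isEquivalence
    ; irrefl        = λ { refl ((_ , _ , a≢a) , _) → a≢a refl }
    ; trans         = ≺-trans
    ; <-resp-≈      = (λ { refl p → p }) , (λ { refl p → p })
    }

  ≺-minimal : ∀ i {X : Pred (Fin n) 0ℓ} → Decidable X → ∀ {x} → X x →
    ∃ λ y → X y × (∀ {z} → X z → ¬ i ⊢ z ≺ y)
  ≺-minimal i {X} X? {x} Xx = go Xx (≺-wellFounded i x)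
    where
    go : ∀ {x} → X x → Acc (i ⊢_≺_) x → ∃ λ y → X y × (∀ {z} → X z → ¬ i ⊢ z ≺ y)
    go {x} Xx (acc rs) with Fin.any? (λ y → X? y ×-dec (i ⊢ y ≺? x))
    ... | yes (y , Xy , y≺x) = go Xy (rs y≺x)
    ... | no ∄ = x , Xx , λ Xz z≺x → ∄ (_ , Xz , z≺x)

  rank-< : ∀ {i z w} → i ⊢ z ≺ w → rank i z N.< rank i w
  rank-< {i} {z} {w} z≺w = length-filter-< (i ⊢_≺? z) (i ⊢_≺? w) (Unique.allFin⁺ n)
    (λ p → ≺-trans p z≺w) (Mem.∈-allFin z) (λ { ((_ , _ , z≢z) , _) → z≢z refl }) z≺w

  rank-bound : ∀ i z → rank i z N.< n
  rank-bound i z = subst (rank i z N.<_)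
    (trans (cong length (List.filter-all always? {xs = allFin n} (All.tabulate λ _ → tt))) (List.length-tabulate {n = n} (λ i → i)))
    (length-filter-< (i ⊢_≺? z) always? (Unique.allFin⁺ n) (λ _ → tt)
      (Mem.∈-allFin z) (λ { ((_ , _ , z≢z) , _) → z≢z refl }) tt)
    where
    always? : Decidable {A = Fin n} (λ _ → ⊤)
    always? _ = yes tt

  rank-injective : ∀ {i z w} → i ≢ z → i ≢ w → rank i z ≡ rank i w → z ≡ w
  rank-injective {i} {z} {w} i≢z i≢w eq with z ≟ w
  ... | yes z≡w = z≡w
  ... | no z≢w with ≺-total i≢z i≢w z≢w
  ...   | inj₁ z≺w = contradiction eq (ℕ.<⇒≢ (rank-< z≺w))
  ...   | inj₂ w≺z = contradiction (sym eq) (ℕ.<⇒≢ (rank-< w≺z))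

  -- Distinct lines have distinct ranks on `i`, so only `z` itself can witness the bit at its rank.
  replaceBit-rank : ∀ {i z} → i ≢ z → replaceBit i (rank i z) ≡ does (i <? z)
  replaceBit-rank {i} {z} i≢z = ≡-does (rightAt? i (rank i z)) (i <? z)
    (λ { (w , i≢w , eq , i<w) → subst (i <_) (rank-injective i≢w i≢z eq) i<w })
    (λ i<z → z , i≢z , refl , i<z)

  -- When `v` is the highest of the three lines, the single colour of the triple tells on both lower
  -- lines alike whether `v` comes before their common crossing. So "before `v`" and "after `v`" are
  -- properties of a crossing, not of a crossing on a chosen line.
  ≺-top : ∀ {v i a} → i < v → a < v → i ⊢ v ≺ a → a ⊢ v ≺ i
  ≺-top {v} {i} {a} i<v a<v p@((i≢v , i≢a , v≢a) , _) = (v≢a ∘ sym , i≢a ∘ sym , i≢v ∘ sym) , (begin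
    colour a v i  ≡⟨ colour-swap₂₃ (v≢a ∘ sym) (i≢a ∘ sym) (i≢v ∘ sym) ⟩
    colour a i v  ≡⟨ colour-swap₁₂ (i≢a ∘ sym) (v≢a ∘ sym) i≢v ⟩
    colour i a v  ≡⟨ ≺-down′ a<v p ⟩
    false         ≡⟨ dec-false (v <? i) (Fin.<-asym i<v) ⟨
    does (v <? i) ∎)
    where open ≡-Reasoning

  -- The hypothesis of an induction over crossings among the lines below `m`: `Q i j` concerns the
  -- crossing of `i` and `j`, and may be derived from the earlier crossings on both lines.
  record Progressive (m : ℕ) (Q : Fin n → Fin n → Set) : Set where
    field
      symmetric : ∀ {i j} → toℕ i N.< m → toℕ j N.< m → Q i j → Q j i
      step : ∀ {i j} → toℕ i N.< m → toℕ j N.< m → i ≢ j →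
        (∀ {a} → toℕ a N.< m → i ⊢ a ≺ j → Q i a) →
        (∀ {a} → toℕ a N.< m → j ⊢ a ≺ i → Q j a) → Q i j

  -- The crossings are well-founded under "earlier on a common line". Adding a top line v splits the
  -- old crossings into those before v and those after v; the former, then the crossings on v in the
  -- order of v, then the latter can be treated in turn.
  sweep : ∀ m → m ≤ n → ∀ {Q} → Progressive m Q →
    ∀ {i j} → toℕ i N.< m → toℕ j N.< m → i ≢ j → Q i j
  sweep (suc m) m<n {Q} prog = λ i< j< i≢j → all (split i<) (split j<) i≢j
    where
    open Progressive prog

    v : Fin n
    v = fromℕ< m<n

    toℕ-v : toℕ v ≡ m
    toℕ-v = Fin.toℕ-fromℕ< m<n

    up : ∀ {i : Fin n} → toℕ i N.< m → toℕ i N.< suc m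
    up = ℕ.m<n⇒m<1+n

    v< : toℕ v N.< suc m
    v< = s≤s (ℕ.≤-reflexive toℕ-v)

    below : ∀ {i : Fin n} → toℕ i N.< m → i < v
    below {i} = subst (toℕ i N.<_) (sym toℕ-v)

    split : ∀ {i : Fin n} → toℕ i N.< suc m → toℕ i N.< m ⊎ i ≡ v
    split i< with ℕ.m<1+n⇒m<n∨m≡n i<
    ... | inj₁ p = inj₁ p
    ... | inj₂ p = inj₂ (Fin.toℕ-injective (trans p (sym toℕ-v)))

    early : ∀ {i j} → toℕ i N.< m → toℕ j N.< m → i ≢ j → ¬ i ⊢ v ≺ j → Q i j
    -- The induction is applied to `Q` relativised to crossings that do not come after `v`. By
    -- `≺-top` this condition is symmetric in the two lines.
    early = sweep m (ℕ.<⇒≤ m<n) {λ i j → ¬ i ⊢ v ≺ j → Q i j} record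
      { symmetric = λ i< j< q ¬p → symmetric (up i<) (up j<) (q (¬p ∘ ≺-top (below i<) (below j<)))
      ; step = λ i< j< i≢j hᵢ hⱼ ¬p →
          let ¬p′ = ¬p ∘ ≺-top (below j<) (below i<) in
          step (up i<) (up j<) i≢j (before hᵢ ¬p) (before hⱼ ¬p′)
      }
      where
      before : ∀ {i j} → (∀ {a} → toℕ a N.< m → i ⊢ a ≺ j → ¬ i ⊢ v ≺ a → Q i a) → ¬ i ⊢ v ≺ j →
        ∀ {a} → toℕ a N.< suc m → i ⊢ a ≺ j → Q i a
      before h ¬p a< a≺j with split a<
      ... | inj₁ a<m  = h a<m a≺j (λ v≺a → ¬p (≺-trans v≺a a≺j))
      ... | inj₂ refl = contradiction a≺j ¬p

    on-v : ∀ {i} → toℕ i N.< m → Q i v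
    on-v {i} i< = go i< (≺-wellFounded v i)
      where
      go : ∀ {i} → toℕ i N.< m → Acc (v ⊢_≺_) i → Q i v
      go {i} i< (acc rs) = step (up i<) v< (Fin.<⇒≢ (below i<)) beforeᵢ beforeᵥ
        where
        beforeᵢ : ∀ {a} → toℕ a N.< suc m → i ⊢ a ≺ v → Q i a
        beforeᵢ a< a≺v@((i≢a , _ , a≢v) , _) with split a<
        ... | inj₁ a<m = early i< a<m i≢a (≺-asym a≺v)
        ... | inj₂ a≡v = contradiction a≡v a≢v

        beforeᵥ : ∀ {a} → toℕ a N.< suc m → v ⊢ a ≺ i → Q v a
        beforeᵥ a< a≺i@((v≢a , _ , _) , _) with split a<
        ... | inj₁ a<m = symmetric (up a<m) v< (go a<m (rs a≺i))
        ... | inj₂ a≡v = contradiction (sym a≡v) v≢a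

    old : ∀ {i j} → toℕ i N.< m → toℕ j N.< m → i ≢ j → Q i j
    -- A second induction, now for `Q` itself: when `v` is among the earlier lines, `on-v` supplies
    -- its crossing.
    old = sweep m (ℕ.<⇒≤ m<n) {Q} record
      { symmetric = λ i< j< → symmetric (up i<) (up j<)
      ; step = λ i< j< i≢j hᵢ hⱼ → step (up i<) (up j<) i≢j (before i< hᵢ) (before j< hⱼ)
      }
      where
      before : ∀ {i j} → toℕ i N.< m → (∀ {a} → toℕ a N.< m → i ⊢ a ≺ j → Q i a) →
        ∀ {a} → toℕ a N.< suc m → i ⊢ a ≺ j → Q i a
      before i< h a< a≺j with split a<
      ... | inj₁ a<m  = h a<m a≺j
      ... | inj₂ refl = on-v i<

    all : ∀ {i j} → toℕ i N.< m ⊎ i ≡ v → toℕ j N.< m ⊎ j ≡ v → i ≢ j → Q i j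
    all (inj₁ i<)   (inj₁ j<)   i≢j = old i< j< i≢j
    all (inj₁ i<)   (inj₂ refl) _   = on-v i<
    all (inj₂ refl) (inj₁ j<)   _   = symmetric (up j<) v< (on-v j<)
    all (inj₂ refl) (inj₂ refl) i≢j = contradiction refl i≢j

-- Two arrangements with the same replace bits

module Replace {n : ℕ} {f f′ : Fin n → Fin n → Fin n → Bool} (sig : Signotope f) (sig′ : Signotope f′)
  (same-bits : ∀ i {k} → k N.< n → Colour.replaceBit f i k ≡ Colour.replaceBit f′ i k) where

  private
    module L = Lines sig
    module L′ = Lines sig′
  open L using (_⊢_≺_; _⊢_≺?_)
  open L′ using () renaming (_⊢_≺_ to _⊢′_≺_; _⊢_≺?_ to _⊢′_≺?_)

  -- The property to be swept over the crossings of the first arrangement.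
  Agree : Fin n → Fin n → Set
  Agree i j = ∀ {x} → x ≢ i → x ≢ j → i ≢ j → L.colour i j x ≡ L′.colour i j x

  agree-sym : ∀ {i j} → Agree i j → Agree j i
  agree-sym ag x≢j x≢i j≢i = trans (L.colour-swap₁₂ j≢i (x≢j ∘ sym) (x≢i ∘ sym))
    (trans (ag x≢i x≢j (j≢i ∘ sym)) (sym (L′.colour-swap₁₂ j≢i (x≢j ∘ sym) (x≢i ∘ sym))))

  agree⇒ : ∀ {i a x} → Agree i a → i ⊢ a ≺ x → i ⊢′ a ≺ x
  agree⇒ ag ((i≢a , i≢x , a≢x) , p) =
    (i≢a , i≢x , a≢x) , trans (sym (ag (i≢x ∘ sym) (a≢x ∘ sym) i≢a)) p

  does-<-not : ∀ {a b : Fin n} → a ≢ b → does (a <? b) ≡ B.not (does (b <? a))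
  does-<-not a≢b = Bool.¬-not (L.does-flip a≢b)

  -- Seen on `i`, the crossing with `j` has slipped behind `x` in the second arrangement.
  Late : Fin n → Fin n → Fin n → Set
  Late i j x = i ⊢′ x ≺ j × ¬ i ⊢ x ≺ j

  late? : ∀ i j → Decidable (Late i j)
  late? i j x = (i ⊢′ x ≺? j) ×-dec ¬? (i ⊢ x ≺? j)

  PredsAgree : Fin n → Fin n → Set
  PredsAgree i j = ∀ {a} → i ⊢ a ≺ j → Agree i a

  module _ {i j : Fin n} (i≢j : i ≢ j) (hᵢ : PredsAgree i j) (hⱼ : PredsAgree j i) where

    -- If `x` preceded `i` on `j` in `f`, then `hⱼ` would give the triple the same colour in both
    -- arrangements, against lateness on `i`. So in `f` the lines `i` and `j` cross each other
    -- before either crosses `x`. The one colour of the triple then equals both comparisons with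
    -- `x`, so `x` does not lie between `i` and `j`.
    late-swap : ∀ {x} → Late i j x → Late j i x × does (i <? x) ≡ does (j <? x)
    late-swap {x} (x≺′j@((i≢x , _ , x≢j) , p) , x⊀j) = (x≺′i , x⊀i) , outside
      where
      open ≡-Reasoning

      x⊀i : ¬ j ⊢ x ≺ i
      x⊀i x≺i = x⊀j ((i≢x , i≢j , x≢j) , (begin
        L.colour i x j   ≡⟨ L.colour-swap₂₃ i≢x i≢j x≢j ⟩
        L.colour i j x   ≡⟨ L.colour-swap₁₂ i≢j i≢x (x≢j ∘ sym) ⟩
        L.colour j i x   ≡⟨ L.colour-swap₂₃ (i≢j ∘ sym) (x≢j ∘ sym) i≢x ⟩
        L.colour j x i   ≡⟨ hⱼ x≺i i≢j i≢x (x≢j ∘ sym) ⟩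
        L′.colour j x i  ≡⟨ L′.colour-swap₂₃ (x≢j ∘ sym) (i≢j ∘ sym) (i≢x ∘ sym) ⟩
        L′.colour j i x  ≡⟨ L′.colour-swap₁₂ (i≢j ∘ sym) (x≢j ∘ sym) i≢x ⟩
        L′.colour i j x  ≡⟨ L′.colour-swap₂₃ i≢j i≢x (x≢j ∘ sym) ⟩
        L′.colour i x j  ≡⟨ p ⟩
        does (x <? j)    ∎))

      j≺x : i ⊢ j ≺ x
      j≺x with L.≺-total i≢j i≢x (x≢j ∘ sym)
      ... | inj₁ q = q
      ... | inj₂ q = contradiction q x⊀j

      i≺x : j ⊢ i ≺ x
      i≺x with L.≺-total (i≢j ∘ sym) (x≢j ∘ sym) i≢x
      ... | inj₁ q = q
      ... | inj₂ q = contradiction q x⊀i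

      outside : does (i <? x) ≡ does (j <? x)
      outside = begin
        does (i <? x)   ≡⟨ proj₂ i≺x ⟨
        L.colour j i x  ≡⟨ L.colour-swap₁₂ (i≢j ∘ sym) (x≢j ∘ sym) i≢x ⟩
        L.colour i j x  ≡⟨ proj₂ j≺x ⟩
        does (j <? x)   ∎

      x≺′i : j ⊢′ x ≺ i
      x≺′i = (x≢j ∘ sym , i≢j ∘ sym , i≢x ∘ sym) , (begin
        L′.colour j x i        ≡⟨ L′.colour-swap₂₃ (x≢j ∘ sym) (i≢j ∘ sym) (i≢x ∘ sym) ⟩
        L′.colour j i x        ≡⟨ L′.colour-swap₁₂ (i≢j ∘ sym) (x≢j ∘ sym) i≢x ⟩
        L′.colour i j x        ≡⟨ L′.colour-swap₂₃ i≢j i≢x (x≢j ∘ sym) ⟩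
        L′.colour i x j        ≡⟨ p ⟩
        does (x <? j)          ≡⟨ does-<-not x≢j ⟩
        B.not (does (j <? x))  ≡⟨ cong B.not outside ⟨
        B.not (does (i <? x))  ≡⟨ does-<-not (i≢x ∘ sym) ⟨
        does (x <? i)          ∎)

    -- The first late line on i has the rank in f′ that j has in f, so the replace bits put it on
    -- the same side of i as j.
    first-late : ∀ {x} → Late i j x → ∃ λ y → Late i j y × does (i <? y) ≡ does (i <? j) ×
      (∀ {z} → i ≢ z → y ≢ z → ¬ i ⊢ z ≺ j → i ⊢′ y ≺ z)
    first-late late
      with y , late-y@(y≺′j@((i≢y , _ , y≢j) , _) , y⊀j) , min ← L′.≺-minimal i (late? i j) late =
      y , late-y , same-side , first
      where
      first : ∀ {z} → i ≢ z → y ≢ z → ¬ i ⊢ z ≺ j → i ⊢′ y ≺ z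
      first i≢z y≢z z⊀j with L′.≺-total i≢y i≢z y≢z
      ... | inj₁ y≺′z = y≺′z
      ... | inj₂ z≺′y = contradiction z≺′y (min (L′.≺-trans z≺′y y≺′j , z⊀j))

      j≺y : i ⊢ j ≺ y
      j≺y with L.≺-total i≢j i≢y (y≢j ∘ sym)
      ... | inj₁ q = q
      ... | inj₂ q = contradiction q y⊀j

      -- The lines before `y` in `f′` are exactly those before `j` in `f`: one inclusion is the
      -- minimality of `y`, the other comes from `hᵢ`.
      preds⇒ : ∀ {z} → i ⊢′ z ≺ y → i ⊢ z ≺ j
      preds⇒ {z} z≺′y with i ⊢ z ≺? j
      ... | yes z≺j = z≺j
      ... | no z⊀j  = contradiction z≺′y (min (L′.≺-trans z≺′y y≺′j , z⊀j))

      preds⇐ : ∀ {z} → i ⊢ z ≺ j → i ⊢′ z ≺ y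
      preds⇐ z≺j = agree⇒ (hᵢ z≺j) (L.≺-trans z≺j j≺y)

      same-rank : L.rank i j ≡ L′.rank i y
      same-rank = cong length (List.filter-≐ (i ⊢_≺? j) (i ⊢′_≺? y) (preds⇐ , preds⇒) (allFin n))

      same-side : does (i <? y) ≡ does (i <? j)
      same-side = begin
        does (i <? y)                    ≡⟨ L′.replaceBit-rank i≢y ⟨
        L′.replaceBit i (L′.rank i y)    ≡⟨ cong (L′.replaceBit i) same-rank ⟨
        L′.replaceBit i (L.rank i j)     ≡⟨ same-bits i (L.rank-bound i j) ⟨
        L.replaceBit i (L.rank i j)      ≡⟨ L.replaceBit-rank i≢j ⟩
        does (i <? j)                    ∎
        where open ≡-Reasoning

  does-true : ∀ {a b : Fin n} → does (a <? b) ≡ true → a < b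
  does-true {a} {b} eq with a <? b
  ... | yes p = p
  ... | no ¬p = contradiction (trans (sym eq) (dec-false (a <? b) ¬p)) λ ()

  does-false : ∀ {a b : Fin n} → a ≢ b → does (a <? b) ≡ false → b < a
  does-false {a} {b} a≢b eq = does-true (trans (does-<-not (a≢b ∘ sym)) (cong B.not eq))

  -- The three crossing orders say that `f′ w i j` and `f′ w j x` are `true` while `f′ w i x`, which
  -- lies between them, is `false`.
  no-alternation : ∀ {w i j x} → w < i → i < j → j < x →
    i ⊢′ x ≺ w → j ⊢′ w ≺ x → ¬ j ⊢′ w ≺ i
  no-alternation {w} {i} {j} {x} w<i i<j j<x x≺w w≺x w≺i = contradiction (begin
    true             ≡⟨ wij≡true ⟨
    f′ w i j         ≡⟨ Signotope.s₁₂₃ sig′ w<i i<j j<x (trans wij≡true (sym wjx≡true)) ⟨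
    f′ w i x         ≡⟨ L′.colour-yxz w<i i<x ⟨
    L′.colour i w x  ≡⟨ L′.≺-down′ (Fin.<-trans w<i i<x) x≺w ⟩
    false            ∎) λ ()
    where
    open ≡-Reasoning

    i<x : i < x
    i<x = Fin.<-trans i<j j<x

    wij≡true : f′ w i j ≡ true
    wij≡true = trans (sym (L′.colour-zxy w<i i<j)) (L′.≺-up w<i w≺i)

    wjx≡true : f′ w j x ≡ true
    wjx≡true = trans (sym (L′.colour-yxz (Fin.<-trans w<i i<j) j<x)) (L′.≺-up (Fin.<-trans w<i i<x) w≺x)

  -- If the lines i < j met later in f′ than in f, then the first late lines x on i and w on j would
  -- satisfy w < i < j < x, and f′ would alternate on these four lines.
  no-late : ∀ {i j} → i < j → PredsAgree i j → PredsAgree j i → ∀ {x} → ¬ Late i j x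
  no-late {i} {j} i<j hᵢ hⱼ late =
    let i≢j = Fin.<⇒≢ i<j
        x , late-x , x-side , x-first = first-late i≢j hᵢ hⱼ late
        late-x′ , x-outside = late-swap i≢j hᵢ hⱼ late-x
        w , late-w , w-side , w-first = first-late (i≢j ∘ sym) hⱼ hᵢ late-x′
        late-w′ , w-outside = late-swap (i≢j ∘ sym) hⱼ hᵢ late-w
        w≢i = proj₂ (proj₂ (proj₁ (proj₁ late-w)))
        -- `x` is on the same side of `i` as `j` and not between them, hence above `j`; likewise `w`
        -- is below `i`.
        j<x = does-true (trans (sym x-outside) (trans x-side (dec-true (i <? j) i<j)))
        w<i = does-false (w≢i ∘ sym) (trans (sym w-outside) (trans w-side (dec-false (j <? i) (Fin.<-asym i<j))))
        w<x = Fin.<-trans w<i (Fin.<-trans i<j j<x)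
    in no-alternation w<i i<j j<x
         -- By `late-swap`, `w` is late on `i` too and `x` on `j`. As first late lines, `x` precedes
         -- `w` on `i` and `w` precedes `x` on `j` in `f′`.
         (x-first (w≢i ∘ sym) (Fin.<⇒≢ w<x ∘ sym) (proj₂ late-w′))
         (w-first (Fin.<⇒≢ j<x) (Fin.<⇒≢ w<x) (proj₂ late-x′))
         (proj₁ late-w)

  -- If `x` precedes `j` on `i` in `f`, the crossing of `i` and `x` has already been treated.
  -- Otherwise a disagreement makes `x` late on `i`, and by `late-swap` on `j` as well, so `no-late`
  -- applies with the smaller of the two lines first.
  agree-step : ∀ {i j} → i ≢ j → PredsAgree i j → PredsAgree j i → Agree i j
  agree-step {i} {j} i≢j hᵢ hⱼ {x} x≢i x≢j _ with L.≺-total (x≢i ∘ sym) i≢j x≢j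
  ... | inj₁ x≺j = begin
    L.colour i j x   ≡⟨ L.colour-swap₂₃ i≢j (x≢i ∘ sym) (x≢j ∘ sym) ⟩
    L.colour i x j   ≡⟨ hᵢ x≺j (i≢j ∘ sym) (x≢j ∘ sym) (x≢i ∘ sym) ⟩
    L′.colour i x j  ≡⟨ L′.colour-swap₂₃ (x≢i ∘ sym) i≢j x≢j ⟩
    L′.colour i j x  ∎
    where open ≡-Reasoning
  ... | inj₂ j≺x with L′.≺-total (x≢i ∘ sym) i≢j x≢j
  ...   | inj₂ j≺′x = trans (proj₂ j≺x) (sym (proj₂ j≺′x))
  ...   | inj₁ x≺′j with Fin.<-cmp i j
  ...     | tri≈ _ i≡j _ = contradiction i≡j i≢j
  ...     | tri< i<j _ _ = contradiction (x≺′j , L.≺-asym j≺x) (no-late i<j hᵢ hⱼ)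
  ...     | tri> _ _ j<i = contradiction (proj₁ (late-swap i≢j hᵢ hⱼ (x≺′j , L.≺-asym j≺x))) (no-late j<i hⱼ hᵢ)

  agree : ∀ {i j} → i ≢ j → Agree i j
  agree = L.sweep n ℕ.≤-refl record
    { symmetric = λ _ _ → agree-sym
    ; step = λ _ _ i≢j hᵢ hⱼ → agree-step i≢j (hᵢ (Fin.toℕ<n _)) (hⱼ (Fin.toℕ<n _))
    } (Fin.toℕ<n _) (Fin.toℕ<n _)

  replaceBits-injective : ∀ {x y z} → x < y → y < z → f x y z ≡ f′ x y z
  replaceBits-injective x<y y<z = subst₂ _≡_ (L.colour-xyz x<y y<z) (L′.colour-xyz x<y y<z)
    (agree (Fin.<⇒≢ x<y) (Fin.<⇒≢ (Fin.<-trans x<y y<z) ∘ sym) (Fin.<⇒≢ y<z ∘ sym) (Fin.<⇒≢ x<y))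

-- Counting 3-monotone colourings

tripleColour : ∀ {n} → Coloring n 3 → Fin n → Fin n → Fin n → Bool
tripleColour c x y z = c (x ∷ y ∷ z ∷ [])

monotone⇒signotope : ∀ {n} (c : Coloring n 3) → Monotone n 3 c → Signotope (tripleColour c)
monotone⇒signotope {n} c mono = record
  -- Deleting position 3 leaves the first triple and deleting position 0 the last, so subscript t
  -- corresponds to deletion 4 - t.
  { s₁₂₃ = λ p q r → between (at p q r (# 1) (# 2) (# 3) (s≤s (s≤s z≤n)) (s≤s (s≤s (s≤s z≤n))))
  ; s₁₂₄ = λ p q r → between (at p q r (# 0) (# 2) (# 3) (s≤s z≤n) (s≤s (s≤s (s≤s z≤n))))
  ; s₁₃₄ = λ p q r → between (at p q r (# 0) (# 1) (# 3) (s≤s z≤n) (s≤s (s≤s z≤n)))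
  ; s₂₃₄ = λ p q r → between (at p q r (# 0) (# 1) (# 2) (s≤s z≤n) (s≤s (s≤s z≤n)))
  }
  where
  at : ∀ {i j k l : Fin n} → i < j → j < k → k < l → MonotoneAt c (i ∷ j ∷ k ∷ l ∷ [])
  at p q r = All.lookup mono (rSubsets⁺
    ((p ∷ Fin.<-trans p q ∷ Fin.<-trans p (Fin.<-trans q r) ∷ []) ∷ (q ∷ Fin.<-trans q r ∷ []) ∷ (r ∷ []) ∷ [] ∷ []))

  between : ∀ {a b d} → (a B.≤ b × b B.≤ d) ⊎ (d B.≤ b × b B.≤ a) → a ≡ d → b ≡ a
  between (inj₁ (p , q)) refl = Bool.≤-antisym q p
  between (inj₂ (p , q)) refl = Bool.≤-antisym q p

-- One replace bit for each of `n` lines and each rank below `n` determines the colouring.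
S₃-upper : ∀ n → S 3 n ≤ 2 ^ (n * n)
S₃-upper n = subst (S 3 n ≤_) (length-boolLists (n * n))
  (injection⇒length≤ encode (monotoneTables-unique 3 n) (λ {bs} _ → boolLists⁺ (encode bs) (length-encode bs)) inj)
  where
  entries : List (Fin n × ℕ)
  entries = cartesianProduct (allFin n) (upTo n)

  col : List Bool → Fin n → Fin n → Fin n → Bool
  col bs = tripleColour (fromTable (rSubsets n 3) bs)

  encode : List Bool → List Bool
  encode bs = map (λ (i , k) → Colour.replaceBit (col bs) i k) entries

  length-encode : ∀ bs → length (encode bs) ≡ n * n
  length-encode bs = begin
    length (encode bs)                        ≡⟨ List.length-map _ entries ⟩
    length entries                            ≡⟨ length-cartesianProductWith _,_ (allFin n) (upTo n) ⟩
    length (allFin n) * length (upTo n)       ≡⟨ cong₂ _*_ (List.length-tabulate {n = n} (λ i → i)) (List.length-upTo n) ⟩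
    n * n                                     ∎
    where open ≡-Reasoning

  inj : ∀ {bs cs} → bs ∈ monotoneTables 3 n → cs ∈ monotoneTables 3 n → encode bs ≡ encode cs → bs ≡ cs
  inj {bs} {cs} bs∈ cs∈ eq = fromTable-injective (rSubsets-unique n 3)
    (proj₁ (∈-monotoneTables⁻ {3} {n} bs∈)) (proj₁ (∈-monotoneTables⁻ {3} {n} cs∈)) (same-colour ∘ rSubsets⁻ n 3)
    where
    module R = Replace (monotone⇒signotope (fromTable (rSubsets n 3) bs) (proj₂ (∈-monotoneTables⁻ {3} {n} bs∈)))
      (monotone⇒signotope (fromTable (rSubsets n 3) cs) (proj₂ (∈-monotoneTables⁻ {3} {n} cs∈)))
      (λ i k<n → map-injective-∈ eq (Mem.∈-cartesianProduct⁺ (Mem.∈-allFin i) (Mem.∈-upTo⁺ k<n)))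

    same-colour : ∀ {T} → Increasing T → fromTable (rSubsets n 3) bs T ≡ fromTable (rSubsets n 3) cs T
    same-colour {x ∷ y ∷ z ∷ []} ((x<y ∷ _) ∷ (y<z ∷ []) ∷ _) = R.replaceBits-injective x<y y<z

-- The upper bound

-- The two leading terms of the binomial expansion of `suc n ^ suc s`, the second one,
-- `suc s * n ^ s`, being split in two.
bernoulli : ∀ s n → s * n ^ s + n ^ suc s + n ^ s ≤ suc n ^ suc s
bernoulli zero    n = ℕ.≤-reflexive (solve 1 (λ n → n :* con 1 :+ con 1 := (con 1 :+ n) :* con 1) refl n)
  where open +-*-Solver
bernoulli (suc s) n = begin
  suc s * (n * n ^ s) + n * (n * n ^ s) + n * n ^ s
    ≤⟨ ℕ.m≤m+n _ (s * n ^ s + n ^ s) ⟩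
  suc s * (n * n ^ s) + n * (n * n ^ s) + n * n ^ s + (s * n ^ s + n ^ s)
    ≡⟨ solve 3 (λ s n x → (con 1 :+ s) :* (n :* x) :+ n :* (n :* x) :+ n :* x :+ (s :* x :+ x)
         := (con 1 :+ n) :* (s :* x :+ n :* x :+ x)) refl s n (n ^ s) ⟩
  suc n * (s * n ^ s + n ^ suc s + n ^ s)
    ≤⟨ ℕ.*-monoʳ-≤ (suc n) (bernoulli s n) ⟩
  suc n * suc n ^ suc s ∎
  where
  open ℕ.≤-Reasoning
  open +-*-Solver

-- Raising to the power `s !` clears the factorial from the exponent. The induction follows
-- `S-split`: the link lowers the uniformity and the restriction lowers the number of vertices.
upper-bound : ∀ t n → let s = suc (suc t) in S (suc s) n ^ (s !) ≤ 2 ^ (2 ^ suc t * n ^ s)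
upper-bound zero n = begin
  S 3 n ^ 2            ≤⟨ ℕ.^-monoˡ-≤ 2 (S₃-upper n) ⟩
  (2 ^ (n * n)) ^ 2    ≡⟨ ℕ.^-*-assoc 2 (n * n) 2 ⟩
  2 ^ (n * n * 2)      ≡⟨ cong (2 ^_) (solve 1 (λ n → n :* n :* con 2 := con 2 :* (n :* (n :* con 1))) refl n) ⟩
  2 ^ (2 * n ^ 2)      ∎
  where
  open ℕ.≤-Reasoning
  open +-*-Solver
-- Without vertices only the empty table exists, so `S` computes to 1.
upper-bound (suc t) zero    = ℕ.≤-trans (ℕ.≤-reflexive (ℕ.^-zeroˡ (suc (suc (suc t)) !))) (ℕ.m^n>0 2 (2 ^ suc (suc t) * 0))
upper-bound (suc t) (suc n) = begin
  S (suc r) (suc n) ^ (r !)              ≤⟨ ℕ.^-monoˡ-≤ (r !) (S-split r n) ⟩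
  (S r n * S (suc r) n) ^ (r !)          ≡⟨ ^-distribʳ-* (r !) (S r n) (S (suc r) n) ⟩
  S r n ^ (r !) * S (suc r) n ^ (r !)    ≤⟨ ℕ.*-mono-≤ link-bound (upper-bound (suc t) n) ⟩
  2 ^ (h * n ^ s * r) * 2 ^ (2 ^ s * n ^ r)  ≡⟨ ℕ.^-distribˡ-+-* 2 (h * n ^ s * r) (2 ^ s * n ^ r) ⟨
  2 ^ (h * n ^ s * r + 2 ^ s * n ^ r)    ≤⟨ ℕ.^-monoʳ-≤ 2 exponent ⟩
  2 ^ (2 ^ s * suc n ^ r)                ∎
  where
  open ℕ.≤-Reasoning
  open +-*-Solver
  s = suc (suc t)
  r = suc s
  h = 2 ^ suc t

  link-bound : S r n ^ (r !) ≤ 2 ^ (h * n ^ s * r)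
  link-bound = begin
    S r n ^ (r * s !)          ≡⟨ cong (S r n ^_) (ℕ.*-comm r (s !)) ⟩
    S r n ^ (s ! * r)          ≡⟨ ℕ.^-*-assoc (S r n) (s !) r ⟨
    (S r n ^ (s !)) ^ r        ≤⟨ ℕ.^-monoˡ-≤ r (upper-bound t n) ⟩
    (2 ^ (h * n ^ s)) ^ r      ≡⟨ ℕ.^-*-assoc 2 (h * n ^ s) r ⟩
    2 ^ (h * n ^ s * r)        ∎

  exponent : h * n ^ s * r + 2 * h * n ^ r ≤ 2 * h * suc n ^ r
  exponent = begin
    -- The link contributes half of what Bernoulli's inequality leaves room for; doubling that term
    -- makes `2 * h` a common factor.
    h * n ^ s * r + 2 * h * n ^ r                      ≤⟨ ℕ.m≤m+n _ (h * n ^ s * r) ⟩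
    h * n ^ s * r + 2 * h * n ^ r + h * n ^ s * r
      ≡⟨ solve 4 (λ h s x y → h :* x :* (con 1 :+ s) :+ con 2 :* h :* y :+ h :* x :* (con 1 :+ s)
           := con 2 :* h :* (s :* x :+ y :+ x)) refl h s (n ^ s) (n ^ r) ⟩
    2 * h * (s * n ^ s + n ^ r + n ^ s)                ≤⟨ ℕ.*-monoʳ-≤ (2 * h) (bernoulli s n) ⟩
    2 * h * suc n ^ r                                  ∎

theorem2p2 : (r n : ℕ) → 3 ≤ r → r ≤ n →
    (2 ^ (n ^ (r ∸ 1)) ≤ S r n ^ (r ^ (4 * r)))
    × (S r n ^ ((r ∸ 1) !) ≤ 2 ^ (2 ^ (r ∸ 2) * n ^ (r ∸ 1)))
theorem2p2 (suc (suc (suc t))) (suc m) (s≤s (s≤s (s≤s _))) (s≤s s≤m) =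
  lower-bound (suc (suc t)) m s≤m , upper-bound t (suc m)
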